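{- Every $4$-regular graph of order $n$ with $n\equiv 0\pmod 4$ is balanceable.
   Context: All graphs are finite, simple and undirected. A $2$-coloring of the edges of the complete graph $K_n$ is a map $\varphi: E(K_n)\to\{R,B\}$. Such a coloring contains a balanced copy of a graph $G$ if there is a subgraph of $K_n$ isomorphic to $G$ whose edge set $E$ can be partitioned into $E_1,E_2$ with $||E_1|-|E_2||\le 1$, $\varphi(e)=R$ for all $e\in E_1$ and $\varphi(e)=B$ for all $e\in E_2$. For a graph $G$ and positive integer $n$, $\mathrm{bal}(n,G)$ is the smallest integer, if it exists, satisfying $\mathrm{bal}(n,G)<\lfloor \frac12\binom n2\rfloor$ such that every $2$-coloring $\varphi$ of $E(K_n)$ with $|\varphi^{ -1}(R)|>\mathrm{bal}(n,G)$ and $|\varphi^{ -1}(B)|>\mathrm{bal}(n,G)$ contains a balanced copy of $G$. A graph $G$ is balanceable if there exists an integer $n_0$ such that $\mathrm{bal}(n,G)$ exists for every integer $n\ge n_0$. -}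

module Defs where

open import Data.Nat using (ℕ; zero; suc; _+_; _≤_; _<_; _≥_; _/_; _<?_)
open import Data.Nat.Divisibility using (_∣_)
open import Data.Nat.Combinatorics using (_C_)
open import Data.Bool using (Bool; true; false; _∧_; if_then_else_)
open import Data.Fin using (Fin; toℕ)
import Data.Fin as F
open import Data.Product using (Σ; ∃; _×_; _,_)
open import Relation.Nullary using (¬_)
open import Relation.Nullary.Decidable using (⌊_⌋)
open import Relation.Binary.PropositionalEquality using (_≡_)
open import Function.Definitions using (Injective)

count : (n : ℕ) → (Fin n → Bool) → ℕ
count zero    p = zero
count (suc n) p = (if p F.zero then 1 else 0) + count n (λ i → p (F.suc i))

sumFin : (n : ℕ) → (Fin n → ℕ) → ℕ
sumFin zero    g = zero
sumFin (suc n) g = g F.zero + sumFin n (λ i → g (F.suc i))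

countPairs : (n : ℕ) → (Fin n → Fin n → Bool) → ℕ
countPairs n p = sumFin n (λ i → count n (λ j → ⌊ toℕ i <? toℕ j ⌋ ∧ p i j))

record Graph (m : ℕ) : Set where
  field
    adj    : Fin m → Fin m → Bool
    sym    : ∀ u v → adj u v ≡ adj v u
    irrefl : ∀ u → adj u u ≡ false
open Graph public

degree : {m : ℕ} → Graph m → Fin m → ℕ
degree {m} G u = count m (λ v → adj G u v)

Regular : {m : ℕ} → ℕ → Graph m → Set
Regular d G = ∀ u → degree G u ≡ d

data Colour : Set where
  R B : Colour

isR : Colour → Bool
isR R = true
isR B = false

isB : Colour → Bool
isB R = false
isB B = true

-- a 2-colouring of E(K_N): a colour for each unordered pair {i,j}, i ≠ j,
-- represented as a symmetric function (diagonal values are never used)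
record Colouring (N : ℕ) : Set where
  field
    col    : Fin N → Fin N → Colour
    colSym : ∀ i j → col i j ≡ col j i
open Colouring public

numR : {N : ℕ} → Colouring N → ℕ
numR {N} φ = countPairs N (λ i j → isR (col φ i j))

numB : {N : ℕ} → Colouring N → ℕ
numB {N} φ = countPairs N (λ i j → isB (col φ i j))

copyR : {m N : ℕ} → Graph m → Colouring N → (Fin m → Fin N) → ℕ
copyR {m} G φ f = countPairs m (λ u v → adj G u v ∧ isR (col φ (f u) (f v)))

copyB : {m N : ℕ} → Graph m → Colouring N → (Fin m → Fin N) → ℕ
copyB {m} G φ f = countPairs m (λ u v → adj G u v ∧ isB (col φ (f u) (f v)))

HasBalancedCopy : {m N : ℕ} → Graph m → Colouring N → Set
HasBalancedCopy {m} {N} G φ =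
  Σ (Fin m → Fin N) λ f → Injective _≡_ _≡_ f
    × (copyR G φ f ≤ suc (copyB G φ f)) × (copyB G φ f ≤ suc (copyR G φ f))

BalProperty : {m : ℕ} → ℕ → Graph m → ℕ → Set
BalProperty N G k =
  (k < (N C 2) / 2) ×
  ((φ : Colouring N) → k < numR φ → k < numB φ → HasBalancedCopy G φ)

IsBal : {m : ℕ} → ℕ → Graph m → ℕ → Set
IsBal N G k = BalProperty N G k × (∀ k′ → k′ < k → ¬ BalProperty N G k′)

Balanceable : {m : ℕ} → Graph m → Set
Balanceable G = ∃ λ n₀ → ∀ N → N ≥ n₀ → ∃ λ k → IsBal N G k

{-# OPTIONS --safe #-}

-- Write n = 4q, so G has 2n edges. If both colour classes have at least ⌊½ C(N,2)⌋ edges and N is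
-- large, Ramsey and Kővári–Sós–Turán arguments yield two n-cliques, monochromatic with colours a and b,
-- whose cross edges all have a colour c, where a, b, c are not all equal. Placing a vertex set X of G
-- in the first clique and the rest in the second gives a balanced copy as soon as the cut of X
-- (if a = b) or the subgraph induced by X or by its complement (if a ≠ b) has exactly n edges.
--
-- A set X with e(X) inner edges has a cut of 4|X| − 2e(X) edges and touches 4|X| − e(X) edges.
-- Averaging the number of X-neighbours over the outside vertices shows that while the cut, resp. the
-- number of touched edges, is below n, some outside vertex has at most one neighbour in X. Adding to an
-- independent set that dominates the rest vertices with exactly one neighbour in X raises the cut by 2
-- or the number of touched edges by 3. For the cut this hits n. For the touched edges the number of
-- missing edges must first be made divisible by 3; see half-touched-triangle.

module Submission where

open import Defs
open import Data.Nat using (ℕ; zero; suc; pred; _+_; _*_; _^_; _≤_; _<_; _≤?_; _<?_; z≤n; s≤s; NonZero; >-nonZero)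
import Data.Nat as ℕ
open import Data.Nat.Combinatorics using (_C_; nCk+nC[k+1]≡[n+1]C[k+1]; nC1≡n)
open import Data.Nat.Divisibility using (_∣_; divides)
open import Data.Nat.DivMod using (_/_; _%_; m≡m%n+[m/n]*n; m%n<n)
open import Data.Nat.Induction using (Acc; acc; <-wellFounded)
open import Data.Nat.ListAction using (sum)
open import Data.Nat.Properties hiding (_≟_; suc-injective)
open import Data.Nat.Tactic.RingSolver using (solve-∀)
open import Algebra.Properties.CommutativeSemigroup +-commutativeSemigroup using (interchange; x∙yz≈y∙xz)
open import Data.Bool using (Bool; true; false; _∧_; not; _xor_; if_then_else_)
import Data.Bool as Bool
open import Data.Empty using (⊥-elim)
open import Data.Fin using (Fin; zero; suc; toℕ; _≟_; inject≤)
open import Data.Fin.Properties using (any?; all?; suc-injective; toℕ-injective; inject≤-injective)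
open import Data.List using (List; []; _∷_; length; filter; map; allFin; tabulate; lookup; take)
open import Data.List.Membership.Propositional.Properties using (∈-lookup)
open import Data.List.Properties using (filter-accept; filter-reject; length-filter; length-tabulate; length-take)
open import Data.List.Relation.Binary.Sublist.Propositional using (_⊆_; []; _∷_; _∷ʳ_; ⊆-refl; ⊆-trans; minimum)
open import Data.List.Relation.Binary.Sublist.Propositional.Properties using (All-resp-⊆; filter-⊆)
open import Data.List.Relation.Unary.All as All using (All; []; _∷_)
open import Data.List.Relation.Unary.All.Properties using (all-filter)
open import Data.List.Relation.Unary.AllPairs as AllPairs using (AllPairs; []; _∷_)
import Data.List.Relation.Unary.AllPairs.Properties as AllPairs
open import Data.List.Relation.Unary.Unique.Propositional.Properties using (allFin⁺)
open import Data.Product using (∃; ∃₂; _×_; _,_; proj₁; proj₂)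
open import Data.Sum using (_⊎_; inj₁; inj₂)
open import Data.Vec.Functional as Vector using (updateAt)
open import Data.Vec.Functional.Properties using (updateAt-updates; updateAt-minimal)
open import Function using (const; _∘_; case_of_)
open import Function.Definitions using (Injective)
open import Relation.Binary.Definitions using (tri<; tri≈; tri>)
open import Relation.Binary.PropositionalEquality renaming (sym to ≡-sym)
open import Relation.Nullary using (¬_; Dec; yes; no; contradiction; ¬?)
open import Relation.Nullary.Decidable using (⌊_⌋; does; map′; _×-dec_; _→-dec_)
open import Relation.Unary using (Decidable)

-- Sums over Fin n

⌊⌋-yes : ∀ {P : Set} (P? : Dec P) → P → ⌊ P? ⌋ ≡ true
⌊⌋-yes (yes _) p = refl
⌊⌋-yes (no ¬p) p = contradiction p ¬p

⌊⌋-no : ∀ {P : Set} (P? : Dec P) → ¬ P → ⌊ P? ⌋ ≡ false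
⌊⌋-no (yes p) ¬p = contradiction p ¬p
⌊⌋-no (no _)  ¬p = refl

⟦_⟧ : Bool → ℕ
⟦ b ⟧ = if b then 1 else 0

⟦∧⟧ : ∀ a b → ⟦ a ∧ b ⟧ ≡ ⟦ a ⟧ * ⟦ b ⟧
⟦∧⟧ true  b = ≡-sym (+-identityʳ ⟦ b ⟧)
⟦∧⟧ false b = refl

sum-cong : ∀ n {f g : Fin n → ℕ} → (∀ i → f i ≡ g i) → sumFin n f ≡ sumFin n g
sum-cong zero    f≡g = refl
sum-cong (suc n) f≡g = cong₂ _+_ (f≡g zero) (sum-cong n (λ i → f≡g (suc i)))

sum-mono : ∀ n {f g : Fin n → ℕ} → (∀ i → f i ≤ g i) → sumFin n f ≤ sumFin n g
sum-mono zero    f≤g = z≤n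
sum-mono (suc n) f≤g = +-mono-≤ (f≤g zero) (sum-mono n (λ i → f≤g (suc i)))

sum-+ : ∀ n (f g : Fin n → ℕ) → sumFin n (λ i → f i + g i) ≡ sumFin n f + sumFin n g
sum-+ zero    f g = refl
sum-+ (suc n) f g = trans
  (cong (f zero + g zero +_) (sum-+ n (λ i → f (suc i)) (λ i → g (suc i))))
  (interchange (f zero) (g zero) _ _)

sum-* : ∀ n k (f : Fin n → ℕ) → sumFin n (λ i → k * f i) ≡ k * sumFin n f
sum-* zero    k f = ≡-sym (*-zeroʳ k)
sum-* (suc n) k f = trans
  (cong (k * f zero +_) (sum-* n k (λ i → f (suc i))))
  (≡-sym (*-distribˡ-+ k (f zero) _))

sum-const : ∀ n k → sumFin n (λ _ → k) ≡ n * k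
sum-const zero    k = refl
sum-const (suc n) k = cong (k +_) (sum-const n k)

sum-swap : ∀ m n (f : Fin m → Fin n → ℕ) →
  sumFin m (λ i → sumFin n (f i)) ≡ sumFin n (λ j → sumFin m (λ i → f i j))
sum-swap zero    n f = ≡-sym (trans (sum-const n 0) (*-zeroʳ n))
sum-swap (suc m) n f = trans
  (cong (sumFin n (f zero) +_) (sum-swap m n (λ i → f (suc i))))
  (≡-sym (sum-+ n (f zero) _))

count≡sum : ∀ n (p : Fin n → Bool) → count n p ≡ sumFin n (λ i → ⟦ p i ⟧)
count≡sum zero    p = refl
count≡sum (suc n) p = cong (⟦ p zero ⟧ +_) (count≡sum n (λ i → p (suc i)))

lt : ∀ {n} → Fin n → Fin n → ℕ
lt i j = ⟦ ⌊ toℕ i <? toℕ j ⌋ ⟧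

lt-irrefl : ∀ {n} (i : Fin n) → lt i i ≡ 0
lt-irrefl i = cong ⟦_⟧ (⌊⌋-no (toℕ i <? toℕ i) (<-irrefl refl))

lt-total : ∀ {n} (i j : Fin n) → i ≢ j → lt i j + lt j i ≡ 1
lt-total i j i≢j with <-cmp (toℕ i) (toℕ j)
... | tri< i<j _ j≮i rewrite ⌊⌋-yes (toℕ i <? toℕ j) i<j | ⌊⌋-no (toℕ j <? toℕ i) j≮i = refl
... | tri≈ _ i≡j _ = contradiction (toℕ-injective i≡j) i≢j
... | tri> i≮j _ j<i rewrite ⌊⌋-yes (toℕ j <? toℕ i) j<i | ⌊⌋-no (toℕ i <? toℕ j) i≮j = refl

pairSum : ∀ n → (Fin n → Fin n → ℕ) → ℕ
pairSum n w = sumFin n (λ i → sumFin n (λ j → lt i j * w i j))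

countPairs≡pairSum : ∀ n p → countPairs n p ≡ pairSum n (λ i j → ⟦ p i j ⟧)
countPairs≡pairSum n p = sum-cong n λ i →
  trans (count≡sum n _) (sum-cong n λ j → ⟦∧⟧ ⌊ toℕ i <? toℕ j ⌋ (p i j))

pairSum-cong : ∀ n {w w′ : Fin n → Fin n → ℕ} →
  (∀ i j → i ≢ j → w i j ≡ w′ i j) → pairSum n w ≡ pairSum n w′
pairSum-cong n {w} {w′} eq = sum-cong n λ i → sum-cong n λ j → pointwise i j
  where
  pointwise : ∀ i j → lt i j * w i j ≡ lt i j * w′ i j
  pointwise i j with i ≟ j
  ... | yes refl rewrite lt-irrefl i = refl
  ... | no i≢j   = cong (lt i j *_) (eq i j i≢j)

pairSum-+ : ∀ n (w w′ : Fin n → Fin n → ℕ) →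
  pairSum n (λ i j → w i j + w′ i j) ≡ pairSum n w + pairSum n w′
pairSum-+ n w w′ = trans
  (sum-cong n λ i → trans (sum-cong n λ j → *-distribˡ-+ (lt i j) (w i j) (w′ i j)) (sum-+ n _ _))
  (sum-+ n _ _)

-- Swapping the summations in the half with `w j i` gives each `w i j` the weight `lt i j + lt j i`,
-- which is 1 off the diagonal; on the diagonal `w` vanishes.
handshake : ∀ n (w : Fin n → Fin n → ℕ) → (∀ i → w i i ≡ 0) →
  pairSum n (λ i j → w i j + w j i) ≡ sumFin n (λ i → sumFin n (w i))
handshake n w w-irrefl = begin
  pairSum n (λ i j → w i j + w j i)
    ≡⟨ pairSum-+ n w (λ i j → w j i) ⟩
  pairSum n w + pairSum n (λ i j → w j i)
    ≡⟨ cong (pairSum n w +_) (sum-swap n n _) ⟩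
  pairSum n w + sumFin n (λ i → sumFin n (λ j → lt j i * w i j))
    ≡⟨ sum-+ n _ _ ⟨
  sumFin n (λ i → sumFin n (λ j → lt i j * w i j) + sumFin n (λ j → lt j i * w i j))
    ≡⟨ sum-cong n (λ i → trans (≡-sym (sum-+ n _ _)) (sum-cong n (pointwise i))) ⟩
  sumFin n (λ i → sumFin n (w i)) ∎
  where
  open ≡-Reasoning
  pointwise : ∀ i j → lt i j * w i j + lt j i * w i j ≡ w i j
  pointwise i j with i ≟ j
  ... | yes refl rewrite w-irrefl i | *-zeroʳ (lt i i) = refl
  ... | no i≢j   = begin
    lt i j * w i j + lt j i * w i j ≡⟨ *-distribʳ-+ (w i j) (lt i j) (lt j i) ⟨
    (lt i j + lt j i) * w i j       ≡⟨ cong (_* w i j) (lt-total i j i≢j) ⟩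
    1 * w i j                       ≡⟨ *-identityˡ (w i j) ⟩
    w i j                           ∎

insert remove : ∀ {n} → (Fin n → Bool) → Fin n → Fin n → Bool
insert X v = updateAt X v (λ _ → true)
remove X v = updateAt X v (λ _ → false)

sum-insert : ∀ {n} (g : Fin n → ℕ) (X : Fin n → Bool) v → X v ≡ false →
  sumFin n (λ w → g w * ⟦ insert X v w ⟧) ≡ g v + sumFin n (λ w → g w * ⟦ X w ⟧)
sum-insert {suc n} g X zero    v∉X rewrite v∉X | *-identityʳ (g zero) | *-zeroʳ (g zero) = refl
sum-insert {suc n} g X (suc v) v∉X = trans
  (cong (g zero * ⟦ X zero ⟧ +_) (sum-insert (λ i → g (suc i)) (λ i → X (suc i)) v v∉X))
  (x∙yz≈y∙xz (g zero * ⟦ X zero ⟧) (g (suc v)) _)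

sum-remove : ∀ {n} (g : Fin n → ℕ) (X : Fin n → Bool) v → X v ≡ true →
  g v + sumFin n (λ w → g w * ⟦ remove X v w ⟧) ≡ sumFin n (λ w → g w * ⟦ X w ⟧)
sum-remove {suc n} g X zero    v∈X rewrite v∈X | *-identityʳ (g zero) | *-zeroʳ (g zero) = refl
sum-remove {suc n} g X (suc v) v∈X = trans
  (x∙yz≈y∙xz (g (suc v)) (g zero * ⟦ X zero ⟧) _)
  (cong (g zero * ⟦ X zero ⟧ +_) (sum-remove (λ i → g (suc i)) (λ i → X (suc i)) v v∈X))

-- Vertex sets of a graph

sum-two : ∀ {n} (f : Fin n → ℕ) i j → i ≢ j → f i + f j ≤ sumFin n f
sum-two f zero    zero    i≢j = contradiction refl i≢j
sum-two f zero    (suc j) i≢j = +-monoʳ-≤ (f zero) (term≤sum (f ∘ suc) j)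
  where
  term≤sum : ∀ {n} (g : Fin n → ℕ) k → g k ≤ sumFin n g
  term≤sum g zero    = m≤m+n (g zero) _
  term≤sum g (suc k) = ≤-trans (term≤sum (g ∘ suc) k) (m≤n+m _ (g zero))
sum-two f (suc i) zero    i≢j = subst (_≤ sumFin _ f) (+-comm (f zero) (f (suc i)))
  (sum-two f zero (suc i) (i≢j ∘ ≡-sym))
sum-two f (suc i) (suc j) i≢j =
  ≤-trans (sum-two (f ∘ suc) i j (i≢j ∘ cong suc)) (m≤n+m _ (f zero))

true≢false : ∀ {b} → b ≡ true → b ≢ false
true≢false refl ()

positive-witness : ∀ n (p : Fin n → Bool) → 1 ≤ sumFin n (λ i → ⟦ p i ⟧) → ∃ λ i → p i ≡ true
positive-witness (suc n) p 1≤Σ with p zero in p0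
... | true  = zero , p0
... | false = let i , pi = positive-witness n (p ∘ suc) 1≤Σ in suc i , pi

two-witnesses : ∀ n (p : Fin n → Bool) → 2 ≤ sumFin n (λ i → ⟦ p i ⟧) →
  ∃₂ λ i j → i ≢ j × p i ≡ true × p j ≡ true
two-witnesses (suc n) p 2≤Σ with p zero in p0
... | true  = let j , pj = positive-witness n (p ∘ suc) (≤-pred 2≤Σ) in
              zero , suc j , (λ ()) , p0 , pj
... | false = let i , j , i≢j , pi , pj = two-witnesses n (p ∘ suc) 2≤Σ in
              suc i , suc j , i≢j ∘ suc-injective , pi , pj

insert-self : ∀ {n} (X : Fin n → Bool) v → insert X v v ≡ true
insert-self X v = updateAt-updates v X

insert-other : ∀ {n} (X : Fin n → Bool) {v w} → w ≢ v → insert X v w ≡ X w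
insert-other X {v} {w} w≢v = updateAt-minimal w v X w≢v

remove-self : ∀ {n} (X : Fin n → Bool) v → remove X v v ≡ false
remove-self X v = updateAt-updates v X

remove-other : ∀ {n} (X : Fin n → Bool) {v w} → w ≢ v → remove X v w ≡ X w
remove-other X {v} {w} w≢v = updateAt-minimal w v X w≢v

∈-insert : ∀ {n} (X : Fin n → Bool) {v w} → insert X v w ≡ true → w ≡ v ⊎ X w ≡ true
∈-insert X {v} {w} w∈ with w ≟ v
... | yes w≡v = inj₁ w≡v
... | no w≢v  = inj₂ (trans (≡-sym (insert-other X w≢v)) w∈)

∉-insert : ∀ {n} (X : Fin n → Bool) {v w} → insert X v w ≡ false → w ≢ v × X w ≡ false
∉-insert X {v} {w} w∉ with w ≟ v
... | yes refl = contradiction w∉ (true≢false (insert-self X v))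
... | no w≢v   = w≢v , trans (≡-sym (insert-other X w≢v)) w∉

∈-remove : ∀ {n} (X : Fin n → Bool) {v w} → remove X v w ≡ true → w ≢ v × X w ≡ true
∈-remove X {v} {w} w∈ with w ≟ v
... | yes refl = contradiction (remove-self X v) (true≢false w∈)
... | no w≢v   = w≢v , trans (≡-sym (remove-other X w≢v)) w∈

∉-remove : ∀ {n} (X : Fin n → Bool) {v w} → w ≢ v → remove X v w ≡ false → X w ≡ false
∉-remove X w≢v w∉ = trans (≡-sym (remove-other X w≢v)) w∉

size : ∀ {n} → (Fin n → Bool) → ℕ
size {n} X = sumFin n (λ v → ⟦ X v ⟧)

∅ : ∀ {n} → Fin n → Bool
∅ _ = false

size-∅ : ∀ n → size {n} ∅ ≡ 0
size-∅ n = trans (sum-const n 0) (*-zeroʳ n)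

size-insert : ∀ {n} (X : Fin n → Bool) v → X v ≡ false → size (insert X v) ≡ suc (size X)
size-insert {n} X v v∉X = begin
  size (insert X v)                          ≡⟨ sum-cong n (λ w → *-identityˡ ⟦ insert X v w ⟧) ⟨
  sumFin n (λ w → 1 * ⟦ insert X v w ⟧)      ≡⟨ sum-insert (const 1) X v v∉X ⟩
  suc (sumFin n (λ w → 1 * ⟦ X w ⟧))         ≡⟨ cong suc (sum-cong n (λ w → *-identityˡ ⟦ X w ⟧)) ⟩
  suc (size X)                               ∎
  where open ≡-Reasoning

size-remove : ∀ {n} (X : Fin n → Bool) v → X v ≡ true → suc (size (remove X v)) ≡ size X
size-remove {n} X v v∈X = begin
  suc (size (remove X v))                    ≡⟨ cong suc (sum-cong n (λ w → *-identityˡ ⟦ remove X v w ⟧)) ⟨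
  suc (sumFin n (λ w → 1 * ⟦ remove X v w ⟧)) ≡⟨ sum-remove (const 1) X v v∈X ⟩
  sumFin n (λ w → 1 * ⟦ X w ⟧)               ≡⟨ sum-cong n (λ w → *-identityˡ ⟦ X w ⟧) ⟩
  size X                                     ∎
  where open ≡-Reasoning

module _ {n : ℕ} (G : Graph n) where

  nbrs : (Fin n → Bool) → Fin n → ℕ
  nbrs X v = sumFin n (λ w → ⟦ adj G v w ⟧ * ⟦ X w ⟧)

  edges : (Fin n → Bool) → ℕ
  edges X = pairSum n (λ u v → ⟦ adj G u v ⟧ * (⟦ X u ⟧ * ⟦ X v ⟧))

  Independent : (Fin n → Bool) → Set
  Independent X = ∀ u v → X u ≡ true → X v ≡ true → adj G u v ≡ false

  2edges : ∀ X → 2 * edges X ≡ sumFin n (λ u → nbrs X u * ⟦ X u ⟧)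
  2edges X = begin
    2 * edges X                                 ≡⟨ cong (edges X +_) (+-identityʳ (edges X)) ⟩
    edges X + edges X                           ≡⟨ cong (edges X +_) (pairSum-cong n λ u v _ → symmetric u v) ⟩
    edges X + pairSum n (λ u v → weight v u)    ≡⟨ pairSum-+ n weight (λ u v → weight v u) ⟨
    pairSum n (λ u v → weight u v + weight v u) ≡⟨ handshake n weight (λ u → cong (λ b → ⟦ b ⟧ * (⟦ X u ⟧ * ⟦ X u ⟧)) (irrefl G u)) ⟩
    sumFin n (λ u → sumFin n (weight u))        ≡⟨ sum-cong n pull-out ⟩
    sumFin n (λ u → nbrs X u * ⟦ X u ⟧)         ∎
    where
    open ≡-Reasoning
    weight : Fin n → Fin n → ℕ
    weight u v = ⟦ adj G u v ⟧ * (⟦ X u ⟧ * ⟦ X v ⟧)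
    symmetric : ∀ u v → weight u v ≡ weight v u
    symmetric u v = cong₂ _*_ (cong ⟦_⟧ (sym G u v)) (*-comm ⟦ X u ⟧ ⟦ X v ⟧)
    rotate : ∀ a b c → a * (b * c) ≡ b * (a * c)
    rotate = solve-∀
    pull-out : ∀ u → sumFin n (weight u) ≡ nbrs X u * ⟦ X u ⟧
    pull-out u = begin
      sumFin n (weight u)
        ≡⟨ sum-cong n (λ v → rotate ⟦ adj G u v ⟧ ⟦ X u ⟧ ⟦ X v ⟧) ⟩
      sumFin n (λ v → ⟦ X u ⟧ * (⟦ adj G u v ⟧ * ⟦ X v ⟧))
        ≡⟨ sum-* n ⟦ X u ⟧ _ ⟩
      ⟦ X u ⟧ * nbrs X u
        ≡⟨ *-comm ⟦ X u ⟧ _ ⟩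
      nbrs X u * ⟦ X u ⟧ ∎

  nbrs-insert : ∀ X v u → X v ≡ false → nbrs (insert X v) u ≡ ⟦ adj G u v ⟧ + nbrs X u
  nbrs-insert X v u = sum-insert (λ w → ⟦ adj G u w ⟧) X v

  nbrs-remove : ∀ X v u → X v ≡ true → ⟦ adj G u v ⟧ + nbrs (remove X v) u ≡ nbrs X u
  nbrs-remove X v u = sum-remove (λ w → ⟦ adj G u w ⟧) X v

  -- In the doubled count `nbrs X v` enters twice: as the row of the new vertex and as the
  -- increments of its neighbours in `X`. Doubling removes the vertex order built into `pairSum`.
  edges-insert : ∀ X v → X v ≡ false → edges (insert X v) ≡ nbrs X v + edges X
  edges-insert X v v∉X = *-cancelˡ-≡ _ _ 2 (begin
    2 * edges (insert X v)
      ≡⟨ 2edges (insert X v) ⟩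
    sumFin n (λ u → nbrs (insert X v) u * ⟦ insert X v u ⟧)
      ≡⟨ sum-insert (nbrs (insert X v)) X v v∉X ⟩
    nbrs (insert X v) v + sumFin n (λ u → nbrs (insert X v) u * ⟦ X u ⟧)
      ≡⟨ cong₂ _+_ at-v (sum-cong n elsewhere) ⟩
    nbrs X v + sumFin n (λ u → ⟦ adj G v u ⟧ * ⟦ X u ⟧ + nbrs X u * ⟦ X u ⟧)
      ≡⟨ cong (nbrs X v +_) (sum-+ n _ _) ⟩
    nbrs X v + (nbrs X v + sumFin n (λ u → nbrs X u * ⟦ X u ⟧))
      ≡⟨ cong (λ k → nbrs X v + (nbrs X v + k)) (2edges X) ⟨
    nbrs X v + (nbrs X v + 2 * edges X)
      ≡⟨ double (nbrs X v) (edges X) ⟩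
    2 * (nbrs X v + edges X) ∎)
    where
    open ≡-Reasoning
    double : ∀ a b → a + (a + 2 * b) ≡ 2 * (a + b)
    double = solve-∀
    at-v : nbrs (insert X v) v ≡ nbrs X v
    at-v = trans (nbrs-insert X v v v∉X) (cong (λ b → ⟦ b ⟧ + nbrs X v) (irrefl G v))
    elsewhere : ∀ u → nbrs (insert X v) u * ⟦ X u ⟧ ≡ ⟦ adj G v u ⟧ * ⟦ X u ⟧ + nbrs X u * ⟦ X u ⟧
    elsewhere u = begin
      nbrs (insert X v) u * ⟦ X u ⟧              ≡⟨ cong (_* ⟦ X u ⟧) (nbrs-insert X v u v∉X) ⟩
      (⟦ adj G u v ⟧ + nbrs X u) * ⟦ X u ⟧       ≡⟨ cong (λ b → (⟦ b ⟧ + nbrs X u) * ⟦ X u ⟧) (sym G u v) ⟩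
      (⟦ adj G v u ⟧ + nbrs X u) * ⟦ X u ⟧       ≡⟨ *-distribʳ-+ ⟦ X u ⟧ ⟦ adj G v u ⟧ (nbrs X u) ⟩
      ⟦ adj G v u ⟧ * ⟦ X u ⟧ + nbrs X u * ⟦ X u ⟧ ∎

  independent⇒edgeless : ∀ X → Independent X → edges X ≡ 0
  independent⇒edgeless X indep = begin
    edges X                   ≡⟨ pairSum-cong n (λ u v _ → no-edge u v) ⟩
    pairSum n (λ _ _ → 0)     ≡⟨ sum-cong n (λ i → sum-cong n (λ j → *-zeroʳ (lt i j))) ⟩
    sumFin n (λ _ → size {n} ∅) ≡⟨ sum-cong n (λ _ → size-∅ n) ⟩
    size {n} ∅                ≡⟨ size-∅ n ⟩
    0                         ∎
    where
    open ≡-Reasoning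
    no-edge : ∀ u v → ⟦ adj G u v ⟧ * (⟦ X u ⟧ * ⟦ X v ⟧) ≡ 0
    no-edge u v with X u in u∈X | X v in v∈X
    ... | false | _     = *-zeroʳ ⟦ adj G u v ⟧
    ... | true  | false = *-zeroʳ ⟦ adj G u v ⟧
    ... | true  | true  rewrite indep u v u∈X v∈X = refl

  unique-nbr : ∀ X {v i j} → nbrs X v ≡ 1 → adj G v i ≡ true → X i ≡ true →
    adj G v j ≡ true → X j ≡ true → i ≡ j
  unique-nbr X {v} {i} {j} v¹ v~i i∈X v~j j∈X with i ≟ j
  ... | yes i≡j = i≡j
  ... | no i≢j  = contradiction two≤one λ { (s≤s ()) }
    where
    two≤one : 2 ≤ 1
    two≤one = subst₂ _≤_
      (cong₂ _+_ (cong₂ (λ a b → ⟦ a ⟧ * ⟦ b ⟧) v~i i∈X) (cong₂ (λ a b → ⟦ a ⟧ * ⟦ b ⟧) v~j j∈X))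
      v¹ (sum-two (λ w → ⟦ adj G v w ⟧ * ⟦ X w ⟧) i j i≢j)

  no-nbr : ∀ X {v} → nbrs X v ≡ 0 → ∀ j → X j ≡ true → adj G v j ≡ false
  no-nbr X {v} v⁰ j j∈X with adj G v j in v~j
  ... | false = refl
  ... | true  = contradiction one≤zero λ ()
    where
    one≤zero : 1 ≤ 0
    one≤zero = subst (1 ≤_) (trans (nbrs-remove X j v j∈X) v⁰)
      (≤-trans (≤-reflexive (cong ⟦_⟧ (≡-sym v~j))) (m≤m+n _ _))

  independent-insert : ∀ {X v} → Independent X → (∀ j → X j ≡ true → adj G v j ≡ false) →
    Independent (insert X v)
  independent-insert {X} {v} indep v≁ a b a∈ b∈ with ∈-insert X a∈ | ∈-insert X b∈
  ... | inj₁ refl | inj₁ refl = irrefl G v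
  ... | inj₁ refl | inj₂ b∈X  = v≁ b b∈X
  ... | inj₂ a∈X  | inj₁ refl = trans (sym G a v) (v≁ a a∈X)
  ... | inj₂ a∈X  | inj₂ b∈X  = indep a b a∈X b∈X

  module _ (regular : Regular 4 G) where

    degree-4 : ∀ u → sumFin n (λ v → ⟦ adj G u v ⟧) ≡ 4
    degree-4 u = trans (≡-sym (count≡sum n (adj G u))) (regular u)

    sum-nbrs : ∀ X → sumFin n (nbrs X) ≡ 4 * size X
    sum-nbrs X = begin
      sumFin n (nbrs X)                                             ≡⟨ sum-swap n n _ ⟩
      sumFin n (λ w → sumFin n (λ u → ⟦ adj G u w ⟧ * ⟦ X w ⟧))     ≡⟨ sum-cong n column ⟩
      sumFin n (λ w → 4 * ⟦ X w ⟧)                                  ≡⟨ sum-* n 4 _ ⟩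
      4 * size X                                                    ∎
      where
      open ≡-Reasoning
      column : ∀ w → sumFin n (λ u → ⟦ adj G u w ⟧ * ⟦ X w ⟧) ≡ 4 * ⟦ X w ⟧
      column w = begin
        sumFin n (λ u → ⟦ adj G u w ⟧ * ⟦ X w ⟧)
          ≡⟨ sum-cong n (λ u → trans (cong (λ b → ⟦ b ⟧ * ⟦ X w ⟧) (sym G u w)) (*-comm ⟦ adj G w u ⟧ ⟦ X w ⟧)) ⟩
        sumFin n (λ u → ⟦ X w ⟧ * ⟦ adj G w u ⟧)
          ≡⟨ sum-* n ⟦ X w ⟧ _ ⟩
        ⟦ X w ⟧ * sumFin n (λ u → ⟦ adj G w u ⟧)
          ≡⟨ cong (⟦ X w ⟧ *_) (degree-4 w) ⟩
        ⟦ X w ⟧ * 4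
          ≡⟨ *-comm ⟦ X w ⟧ 4 ⟩
        4 * ⟦ X w ⟧ ∎

    -- The numbers of `X`-neighbours sum to `4 * size X` over all vertices. The vertices of `X`
    -- account for `2 * edges X` of this, so the first sum counts the edges leaving `X`.
    boundary : ∀ X → sumFin n (λ u → nbrs X u * ⟦ not (X u) ⟧) + 2 * edges X ≡ 4 * size X
    boundary X = begin
      sumFin n (λ u → nbrs X u * ⟦ not (X u) ⟧) + 2 * edges X
        ≡⟨ cong (sumFin n (λ u → nbrs X u * ⟦ not (X u) ⟧) +_) (2edges X) ⟩
      sumFin n (λ u → nbrs X u * ⟦ not (X u) ⟧) + sumFin n (λ u → nbrs X u * ⟦ X u ⟧)
        ≡⟨ sum-+ n _ _ ⟨
      sumFin n (λ u → nbrs X u * ⟦ not (X u) ⟧ + nbrs X u * ⟦ X u ⟧)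
        ≡⟨ sum-cong n (λ u → split (nbrs X u) (X u)) ⟩
      sumFin n (nbrs X)
        ≡⟨ sum-nbrs X ⟩
      4 * size X ∎
      where
      open ≡-Reasoning
      split : ∀ k b → k * ⟦ not b ⟧ + k * ⟦ b ⟧ ≡ k
      split k true  rewrite *-zeroʳ k | *-identityʳ k = refl
      split k false rewrite *-zeroʳ k | *-identityʳ k = +-identityʳ k

    -- Averaging: if every vertex outside `X` and `Z` had two neighbours in `X`, then charging 2 to
    -- each vertex would give 2n ≤ 2|X| + 2|Z| + (4|X| - 2e(X)) by `boundary`, against the
    -- hypothesis.
    light-vertex : ∀ X Z → 2 * size Z + 6 * size X < 2 * n + 2 * edges X →
      ∃ λ v → X v ≡ false × Z v ≡ false × nbrs X v ≤ 1
    light-vertex X Z few with any? (λ v → (X v Bool.≟ false) ×-dec (Z v Bool.≟ false) ×-dec (nbrs X v ≤? 1))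
    ... | yes found = found
    ... | no none   = ⊥-elim (<-irrefl refl (begin-strict
      2 * size Z + 6 * size X
        <⟨ few ⟩
      2 * n + 2 * edges X
        ≡⟨ cong (_+ 2 * edges X) (trans (*-comm 2 n) (≡-sym (sum-const n 2))) ⟩
      sumFin n (const 2) + 2 * edges X
        ≤⟨ +-monoˡ-≤ (2 * edges X) (sum-mono n heavy) ⟩
      sumFin n (λ v → 2 * ⟦ X v ⟧ + (2 * ⟦ Z v ⟧ + nbrs X v * ⟦ not (X v) ⟧)) + 2 * edges X
        ≡⟨ cong (_+ 2 * edges X) (trans (sum-+ n _ _)
           (cong₂ _+_ (sum-* n 2 _) (trans (sum-+ n _ _) (cong (_+ ∂X) (sum-* n 2 _))))) ⟩
      2 * size X + (2 * size Z + ∂X) + 2 * edges X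
        ≡⟨ regroup (size X) (size Z) ∂X (edges X) ⟩
      2 * size Z + 2 * size X + (∂X + 2 * edges X)
        ≡⟨ cong (2 * size Z + 2 * size X +_) (boundary X) ⟩
      2 * size Z + 2 * size X + 4 * size X
        ≡⟨ collect (size Z) (size X) ⟩
      2 * size Z + 6 * size X ∎))
      where
      open ≤-Reasoning
      ∂X : ℕ
      ∂X = sumFin n (λ u → nbrs X u * ⟦ not (X u) ⟧)
      regroup : ∀ x z o e → 2 * x + (2 * z + o) + 2 * e ≡ 2 * z + 2 * x + (o + 2 * e)
      regroup = solve-∀
      collect : ∀ z x → 2 * z + 2 * x + 4 * x ≡ 2 * z + 6 * x
      collect = solve-∀
      heavy : ∀ v → 2 ≤ 2 * ⟦ X v ⟧ + (2 * ⟦ Z v ⟧ + nbrs X v * ⟦ not (X v) ⟧)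
      heavy v with X v in v∉X | Z v in v∉Z
      ... | true  | _     = m≤m+n 2 _
      ... | false | true  = m≤m+n 2 _
      ... | false | false rewrite *-identityʳ (nbrs X v) = ≰⇒> (λ ≤1 → none (v , v∉X , v∉Z , ≤1))

-- Cuts, touched edges and the half cut

module _ {n : ℕ} (G : Graph n) (regular : Regular 4 G) where

  cutEdges : (Fin n → Bool) → ℕ
  cutEdges X = pairSum n (λ u v → ⟦ adj G u v ⟧ * ⟦ X u xor X v ⟧)

  totalEdges : pairSum n (λ u v → ⟦ adj G u v ⟧) ≡ 2 * n
  totalEdges = *-cancelˡ-≡ _ _ 2 (begin
    2 * pairSum n weight                          ≡⟨ cong (pairSum n weight +_) (+-identityʳ _) ⟩
    pairSum n weight + pairSum n weight           ≡⟨ cong (pairSum n weight +_) (pairSum-cong n λ u v _ →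
                                                       cong ⟦_⟧ (sym G u v)) ⟩
    pairSum n weight + pairSum n (λ u v → weight v u) ≡⟨ pairSum-+ n weight _ ⟨
    pairSum n (λ u v → weight u v + weight v u)   ≡⟨ handshake n weight (λ u → cong ⟦_⟧ (irrefl G u)) ⟩
    sumFin n (λ u → sumFin n (weight u))          ≡⟨ sum-cong n (degree-4 G regular) ⟩
    sumFin n (const 4)                            ≡⟨ sum-const n 4 ⟩
    n * 4                                         ≡⟨ double n ⟩
    2 * (2 * n)                                   ∎)
    where
    open ≡-Reasoning
    weight : Fin n → Fin n → ℕ
    weight u v = ⟦ adj G u v ⟧
    double : ∀ m → m * 4 ≡ 2 * (2 * m)
    double = solve-∀

  -- Both sides count the pairs of an edge and an end of it in `X`: a cut edge has one such end, an
  -- inner edge two.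
  cut-formula : ∀ X → cutEdges X + 2 * edges G X ≡ 4 * size X
  cut-formula X = begin
    cutEdges X + 2 * edges G X
      ≡⟨ cong (λ k → cutEdges X + (edges G X + k)) (+-identityʳ (edges G X)) ⟩
    cutEdges X + (edges G X + edges G X)
      ≡⟨ cong (cutEdges X +_) (pairSum-+ n _ _) ⟨
    cutEdges X + pairSum n (λ u v → both u v + both u v)
      ≡⟨ pairSum-+ n _ _ ⟨
    pairSum n (λ u v → ⟦ adj G u v ⟧ * ⟦ X u xor X v ⟧ + (both u v + both u v))
      ≡⟨ pairSum-cong n (λ u v _ → pointwise u v) ⟩
    pairSum n (λ u v → end u v + end v u)
      ≡⟨ handshake n end (λ u → cong (λ b → ⟦ b ⟧ * ⟦ X u ⟧) (irrefl G u)) ⟩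
    sumFin n (nbrs G X)
      ≡⟨ sum-nbrs G regular X ⟩
    4 * size X ∎
    where
    open ≡-Reasoning
    both end : Fin n → Fin n → ℕ
    both u v = ⟦ adj G u v ⟧ * (⟦ X u ⟧ * ⟦ X v ⟧)
    end u v = ⟦ adj G u v ⟧ * ⟦ X v ⟧
    pointwise : ∀ u v → ⟦ adj G u v ⟧ * ⟦ X u xor X v ⟧ + (both u v + both u v) ≡ end u v + end v u
    pointwise u v rewrite sym G v u with adj G u v | X u | X v
    ... | false | _     | _     = refl
    ... | true  | true  | true  = refl
    ... | true  | true  | false = refl
    ... | true  | false | true  = refl
    ... | true  | false | false = refl

  edge-partition : ∀ X → edges G (not ∘ X) + (edges G X + cutEdges X) ≡ 2 * n
  edge-partition X = begin
    edges G (not ∘ X) + (edges G X + cutEdges X)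
      ≡⟨ cong (edges G (not ∘ X) +_) (pairSum-+ n _ _) ⟨
    edges G (not ∘ X) + pairSum n _
      ≡⟨ pairSum-+ n _ _ ⟨
    pairSum n _
      ≡⟨ pairSum-cong n (λ u v _ → pointwise ⟦ adj G u v ⟧ (X u) (X v)) ⟩
    pairSum n (λ u v → ⟦ adj G u v ⟧)
      ≡⟨ totalEdges ⟩
    2 * n ∎
    where
    open ≡-Reasoning
    pointwise : ∀ a b c →
      a * (⟦ not b ⟧ * ⟦ not c ⟧) + (a * (⟦ b ⟧ * ⟦ c ⟧) + a * ⟦ b xor c ⟧) ≡ a
    pointwise a true  true  rewrite *-zeroʳ a | *-identityʳ a = +-identityʳ a
    pointwise a true  false rewrite *-zeroʳ a | *-identityʳ a = refl
    pointwise a false true  rewrite *-zeroʳ a | *-identityʳ a = refl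
    pointwise a false false rewrite *-zeroʳ a | *-identityʳ a = +-identityʳ a

  -- A set touches 4|X| - e(X) edges, so `HalfTouched` asks that n of the 2n edges be touched,
  -- written without subtraction.
  HalfCut HalfTouched : Set
  HalfCut = ∃ λ X → cutEdges X ≡ n
  HalfTouched = ∃ λ X → 4 * size X ≡ n + edges G X

  -- `Z` exempts vertices from domination; a nonempty one arises only when `half-touched-triangle`
  -- drops a vertex of `X`.
  Dominates : (X Z : Fin n → Bool) → Set
  Dominates X Z = ∀ v → X v ≡ false → Z v ≡ false → 1 ≤ nbrs G X v

  dominates-insert : ∀ {X Z v} → X v ≡ false → Dominates X Z → Dominates (insert X v) Z
  dominates-insert {X} {Z} {v} v∉X dom u u∉ u∉Z = let _ , u∉X = ∉-insert X u∉ in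
    ≤-trans (dom u u∉X u∉Z) (≤-trans (m≤n+m _ ⟦ adj G u v ⟧) (≤-reflexive (≡-sym (nbrs-insert G X v u v∉X))))

  private-vertex : ∀ X Z → Dominates X Z → 2 * size Z + 6 * size X < 2 * n + 2 * edges G X →
    ∃ λ v → X v ≡ false × nbrs G X v ≡ 1
  private-vertex X Z dom few = let v , v∉X , v∉Z , ≤1 = light-vertex G regular X Z few in
    v , v∉X , ≤-antisym ≤1 (dom v v∉X v∉Z)

  -- `3 * r` is the number of touched edges still missing. A vertex with a single neighbour in `X`
  -- has four edges, one of them already touched, so each step supplies exactly three.
  fill-by-threes : ∀ r X Z → Dominates X Z → size Z ≤ size X →
    4 * size X + 3 * r ≡ n + edges G X → HalfTouched
  fill-by-threes zero    X Z dom Z≤X eq = X , trans (≡-sym (+-identityʳ _)) eq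
  fill-by-threes (suc r) X Z dom Z≤X eq =
    let v , v∉X , v¹ = private-vertex X Z dom few
        |Xv| = size-insert X v v∉X
    in fill-by-threes r (insert X v) Z (dominates-insert v∉X dom)
         (≤-trans Z≤X (≤-trans (n≤1+n _) (≤-reflexive (≡-sym |Xv|))))
         (begin
           4 * size (insert X v) + 3 * r  ≡⟨ cong (λ k → 4 * k + 3 * r) |Xv| ⟩
           4 * suc (size X) + 3 * r       ≡⟨ shift (size X) r ⟩
           1 + (4 * size X + 3 * suc r)   ≡⟨ cong suc eq ⟩
           1 + (n + edges G X)            ≡⟨ +-suc n (edges G X) ⟨
           n + (1 + edges G X)            ≡⟨ cong (λ k → n + (k + edges G X)) v¹ ⟨
           n + (nbrs G X v + edges G X)   ≡⟨ cong (n +_) (edges-insert G X v v∉X) ⟨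
           n + edges G (insert X v)       ∎)
    where
    open ≡-Reasoning
    shift : ∀ x r → 4 * suc x + 3 * r ≡ 1 + (4 * x + 3 * suc r)
    shift = solve-∀
    -- `size Z ≤ size X` bounds the left side by 8|X|, and twice `eq` says 8|X| + 6(r + 1) = 2n +
    -- 2e(X).
    few : 2 * size Z + 6 * size X < 2 * n + 2 * edges G X
    few = ≤.begin-strict
      2 * size Z + 6 * size X  ≤.≤⟨ +-monoˡ-≤ (6 * size X) (*-monoʳ-≤ 2 Z≤X) ⟩
      2 * size X + 6 * size X  ≤.<⟨ m<m+n _ (s≤s z≤n) ⟩
      2 * size X + 6 * size X + 6 * suc r ≤.≡⟨ double (size X) (suc r) ⟩
      2 * (4 * size X + 3 * suc r) ≤.≡⟨ cong (2 *_) eq ⟩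
      2 * (n + edges G X)          ≤.≡⟨ *-distribˡ-+ 2 n (edges G X) ⟩
      2 * n + 2 * edges G X        ≤.∎
      where
      module ≤ = ≤-Reasoning
      double : ∀ x s → 2 * x + 6 * x + 6 * s ≡ 2 * (4 * x + 3 * s)
      double = solve-∀

  module _ (q : ℕ) (n≡4q : n ≡ 4 * q) where

    -- The equation is half of "the cut plus 2r equals n": a vertex with one neighbour in `X` adds
    -- three cut edges and removes one. Both `edges G X` and `size X` then grow by one, which
    -- preserves the inequality between them.
    fill-by-ones : ∀ r X → Dominates X ∅ → edges G X ≤ size X →
      2 * size X + r ≡ 2 * q + edges G X → HalfCut
    fill-by-ones zero X dom e≤x eq = X , +-cancelʳ-≡ (2 * edges G X) _ _ (begin
      cutEdges X + 2 * edges G X  ≡⟨ cut-formula X ⟩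
      4 * size X                  ≡⟨ double (size X) ⟩
      2 * (2 * size X + 0)        ≡⟨ cong (2 *_) eq ⟩
      2 * (2 * q + edges G X)     ≡⟨ expand q (edges G X) ⟩
      4 * q + 2 * edges G X       ≡⟨ cong (_+ 2 * edges G X) n≡4q ⟨
      n + 2 * edges G X           ∎)
      where
      open ≡-Reasoning
      double : ∀ x → 4 * x ≡ 2 * (2 * x + 0)
      double = solve-∀
      expand : ∀ q e → 2 * (2 * q + e) ≡ 4 * q + 2 * e
      expand = solve-∀
    fill-by-ones (suc r) X dom e≤x eq =
      let v , v∉X , v¹ = private-vertex X ∅ dom few
          |Xv| = size-insert X v v∉X
          eXv  = trans (edges-insert G X v v∉X) (cong (_+ edges G X) v¹)
      in fill-by-ones r (insert X v) (dominates-insert v∉X dom)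
           (subst₂ _≤_ (≡-sym eXv) (≡-sym |Xv|) (s≤s e≤x))
           (begin
             2 * size (insert X v) + r     ≡⟨ cong (λ k → 2 * k + r) |Xv| ⟩
             2 * suc (size X) + r          ≡⟨ shift (size X) r ⟩
             1 + (2 * size X + suc r)      ≡⟨ cong suc eq ⟩
             1 + (2 * q + edges G X)       ≡⟨ +-suc (2 * q) (edges G X) ⟨
             2 * q + suc (edges G X)       ≡⟨ cong (2 * q +_) eXv ⟨
             2 * q + edges G (insert X v)  ∎)
      where
      open ≡-Reasoning
      shift : ∀ x r → 2 * suc x + r ≡ 1 + (2 * x + suc r)
      shift = solve-∀
      -- Since e(X) ≤ |X|, 6|X| + 2e(X) ≤ 8|X| < 4(2|X| + r + 1) = 2n + 4e(X).
      few : 2 * size {n} ∅ + 6 * size X < 2 * n + 2 * edges G X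
      few = +-cancelʳ-< (2 * edges G X) _ _ (≤.begin-strict
        2 * size {n} ∅ + 6 * size X + 2 * edges G X ≤.≡⟨ cong (λ k → 2 * k + 6 * size X + 2 * edges G X) (size-∅ n) ⟩
        6 * size X + 2 * edges G X     ≤.≤⟨ +-monoʳ-≤ (6 * size X) (*-monoʳ-≤ 2 e≤x) ⟩
        6 * size X + 2 * size X        ≤.<⟨ m<m+n _ (s≤s z≤n) ⟩
        6 * size X + 2 * size X + 4 * suc r ≤.≡⟨ quadruple (size X) (suc r) ⟩
        4 * (2 * size X + suc r)       ≤.≡⟨ cong (4 *_) eq ⟩
        4 * (2 * q + edges G X)        ≤.≡⟨ expand q (edges G X) ⟩
        2 * (4 * q) + 2 * edges G X + 2 * edges G X ≤.≡⟨ cong (λ m → 2 * m + 2 * edges G X + 2 * edges G X) n≡4q ⟨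
        2 * n + 2 * edges G X + 2 * edges G X ≤.∎)
        where
        module ≤ = ≤-Reasoning
        quadruple : ∀ x s → 6 * x + 2 * x + 4 * s ≡ 4 * (2 * x + s)
        quadruple = solve-∀
        expand : ∀ q e → 4 * (2 * q + e) ≡ 2 * (4 * q) + 2 * e + 2 * e
        expand = solve-∀

    -- A vertex outside `X` with no neighbour in `X` can be added; when there is none, maximality is
    -- exactly domination.
    extend-or-dominates : ∀ X → Independent G X →
      (∃ λ v → Independent G (insert X v) × size (insert X v) ≡ suc (size X)) ⊎ Dominates X ∅
    extend-or-dominates X indep with any? (λ v → (X v Bool.≟ false) ×-dec (nbrs G X v ℕ.≟ 0))
    ... | yes (v , v∉X , v⁰) = inj₁ (v , independent-insert G indep (no-nbr G X v⁰) , size-insert X v v∉X)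
    ... | no none = inj₂ λ v v∉X _ → n≢0⇒n>0 λ v⁰ → none (v , v∉X , v⁰)

    -- An independent set of `q` vertices cuts 4q = n edges. A smaller one that cannot be extended
    -- dominates, and `fill-by-ones` takes over.
    half-cut-from : ∀ r X → Independent G X → size X + r ≡ q → HalfCut
    half-cut-from zero X indep eq = X , (begin
      cutEdges X                 ≡⟨ +-identityʳ _ ⟨
      cutEdges X + 2 * 0         ≡⟨ cong (λ e → cutEdges X + 2 * e) (independent⇒edgeless G X indep) ⟨
      cutEdges X + 2 * edges G X ≡⟨ cut-formula X ⟩
      4 * size X                 ≡⟨ cong (4 *_) (trans (≡-sym (+-identityʳ _)) eq) ⟩
      4 * q                      ≡⟨ n≡4q ⟨
      n                          ∎)
      where open ≡-Reasoning
    half-cut-from (suc r) X indep eq with extend-or-dominates X indep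
    ... | inj₁ (v , indep′ , |Xv|) = half-cut-from r (insert X v) indep′
      (trans (cong (_+ r) |Xv|) (trans (≡-sym (+-suc (size X) r)) eq))
    -- The cut lacks 4(r + 1) edges and each filling step adds 2.
    ... | inj₂ dom = fill-by-ones (2 * suc r) X dom
      (≤-trans (≤-reflexive e≡0) z≤n)
      (begin
        2 * size X + 2 * suc r  ≡⟨ *-distribˡ-+ 2 (size X) (suc r) ⟨
        2 * (size X + suc r)    ≡⟨ cong (2 *_) eq ⟩
        2 * q                   ≡⟨ +-identityʳ _ ⟨
        2 * q + 0               ≡⟨ cong (2 * q +_) e≡0 ⟨
        2 * q + edges G X       ∎)
      where
      open ≡-Reasoning
      e≡0 : edges G X ≡ 0
      e≡0 = independent⇒edgeless G X indep

    half-cut : HalfCut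
    half-cut = half-cut-from q ∅ (λ _ _ ()) (cong (_+ q) (size-∅ n))

-- Sets touching half of the edges

≢-true : ∀ {b} → b ≢ true → b ≡ false
≢-true {false} _ = refl
≢-true {true}  b≢ = contradiction refl b≢

data ModThree : ℕ → Set where
  3k   : ∀ k → ModThree (3 * k)
  3k+1 : ∀ k → ModThree (3 * k + 1)
  3k+2 : ∀ k → ModThree (3 * k + 2)

mod-three : ∀ m → ModThree m
mod-three zero = 3k 0
mod-three (suc m) with mod-three m
... | 3k k   = subst ModThree (+-comm (3 * k) 1) (3k+1 k)
... | 3k+1 k = subst ModThree (+-suc (3 * k) 1) (3k+2 k)
... | 3k+2 k = subst ModThree (carry k) (3k (suc k))
  where
  carry : ∀ k → 3 * suc k ≡ suc (3 * k + 2)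
  carry = solve-∀

module _ {n : ℕ} (G : Graph n) (regular : Regular 4 G) where

  -- The configuration that continues a stuck independent set: `i` can be exchanged for `b` and `c`
  -- if these are not adjacent, and otherwise the three form a triangle.
  record PrivatePair (X : Fin n → Bool) : Set where
    field
      {i b c} : Fin n
      i∈X : X i ≡ true
      b≢c : b ≢ c
      b∉X : X b ≡ false
      c∉X : X c ≡ false
      b¹  : nbrs G X b ≡ 1
      c¹  : nbrs G X c ≡ 1
      b~i : adj G b i ≡ true
      c~i : adj G c i ≡ true

  private? : ∀ X v → Dec (X v ≡ false × nbrs G X v ≡ 1)
  private? X v = (X v Bool.≟ false) ×-dec (nbrs G X v ℕ.≟ 1)

  privateNbr : (Fin n → Bool) → Fin n → Fin n → Bool
  privateNbr X i v = ⌊ private? X v ⌋ ∧ adj G v i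

  -- Suppose that no vertex of `X` is the only `X`-neighbour of two vertices. Every vertex collects
  -- at least 2: two for membership in `X`, one per neighbour in `X` if outside, and one more if
  -- that neighbour is the only one. In total at most 2|X| + 4|X| + |X| = 7|X| is collected, while
  -- 2n > 8|X|.
  private-pair : ∀ X → Independent G X → Dominates G regular X ∅ → 4 * size X < n → PrivatePair X
  private-pair X indep dom 4x<n
    with any? (λ i → (X i Bool.≟ true) ×-dec (2 ≤? size (privateNbr X i)))
  ... | yes (i , i∈X , 2≤) =
    let b , c , b≢c , bᵖ , cᵖ = two-witnesses n _ 2≤
        (b∉X , b¹) , b~i = unpack b bᵖ
        (c∉X , c¹) , c~i = unpack c cᵖ
    in record { i∈X = i∈X ; b≢c = b≢c ; b∉X = b∉X ; c∉X = c∉X ; b¹ = b¹ ; c¹ = c¹ ; b~i = b~i ; c~i = c~i }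
    where
    unpack : ∀ v → privateNbr X i v ≡ true → (X v ≡ false × nbrs G X v ≡ 1) × adj G v i ≡ true
    unpack v vᵖ with private? X v
    ... | yes v¹ = v¹ , vᵖ
  ... | no none = ⊥-elim (<-irrefl refl (begin-strict
      8 * size X                    ≡⟨ *-assoc 2 4 (size X) ⟩
      2 * (4 * size X)              <⟨ *-monoʳ-< 2 4x<n ⟩
      2 * n                         ≡⟨ trans (*-comm 2 n) (≡-sym (sum-const n 2)) ⟩
      sumFin n (const 2)            ≤⟨ sum-mono n at-least-two ⟩
      sumFin n (λ v → 2 * ⟦ X v ⟧ + (∂ v + P v * nbrs G X v))
        ≡⟨ trans (sum-+ n _ _) (cong₂ _+_ (sum-* n 2 _) (sum-+ n _ _)) ⟩
      2 * size X + (sumFin n ∂ + sumFin n (λ v → P v * nbrs G X v))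
        ≤⟨ +-monoʳ-≤ (2 * size X) (+-mono-≤ (≤-trans (m≤m+n _ _) (≤-reflexive (boundary G regular X))) few-private) ⟩
      2 * size X + (4 * size X + size X) ≡⟨ collect (size X) ⟩
      7 * size X                    ≤⟨ *-monoˡ-≤ (size X) (n≤1+n 7) ⟩
      8 * size X                    ∎))
    where
    open ≤-Reasoning
    collect : ∀ x → 2 * x + (4 * x + x) ≡ 7 * x
    collect = solve-∀
    rotate : ∀ a b c → a * (b * c) ≡ c * (a * b)
    rotate = solve-∀
    P ∂ : Fin n → ℕ
    P v = ⟦ ⌊ private? X v ⌋ ⟧
    ∂ v = nbrs G X v * ⟦ not (X v) ⟧
    at-least-two : ∀ v → 2 ≤ 2 * ⟦ X v ⟧ + (∂ v + P v * nbrs G X v)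
    at-least-two v with X v in v∈ | nbrs G X v in d
    ... | true  | _ = m≤m+n 2 _
    ... | false | zero = contradiction (subst (1 ≤_) d (dom v v∈ refl)) λ ()
    ... | false | suc zero = ≤-refl
    ... | false | suc (suc k) = s≤s (s≤s z≤n)
    -- Double counting of the pairs of a private vertex and its neighbour in `X`, grouped by the
    -- neighbour.
    few-private : sumFin n (λ v → P v * nbrs G X v) ≤ size X
    few-private = begin
      sumFin n (λ v → P v * nbrs G X v)
        ≡⟨ sum-cong n (λ v → sum-* n (P v) _) ⟨
      sumFin n (λ v → sumFin n (λ i → P v * (⟦ adj G v i ⟧ * ⟦ X i ⟧)))
        ≡⟨ sum-swap n n _ ⟩
      sumFin n (λ i → sumFin n (λ v → P v * (⟦ adj G v i ⟧ * ⟦ X i ⟧)))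
        ≡⟨ sum-cong n (λ i → trans (sum-cong n (λ v → trans (rotate (P v) ⟦ adj G v i ⟧ ⟦ X i ⟧)
             (cong (⟦ X i ⟧ *_) (≡-sym (⟦∧⟧ ⌊ private? X v ⌋ (adj G v i)))))) (sum-* n ⟦ X i ⟧ _)) ⟩
      sumFin n (λ i → ⟦ X i ⟧ * size (privateNbr X i))
        ≤⟨ sum-mono n at-most-one ⟩
      size X ∎
      where
      at-most-one : ∀ i → ⟦ X i ⟧ * size (privateNbr X i) ≤ ⟦ X i ⟧
      at-most-one i with X i in i∈X
      ... | false = z≤n
      ... | true  = ≤-trans (≤-reflexive (*-identityˡ _)) (≤-pred (≰⇒> (λ 2≤ → none (i , i∈X , 2≤))))

  -- As `Y` is independent, the three edges are one from `b` to `Y`, one from `c` to `Y` and the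
  -- edge between `b` and `c`. The number of touched edges thus rises by 8 - 3 = 5.
  insert-edge : ∀ Y {b c} → Independent G Y → Y b ≡ false → Y c ≡ false → b ≢ c →
    nbrs G Y b ≡ 1 → nbrs G Y c ≡ 1 → adj G c b ≡ true →
    size (insert (insert Y b) c) ≡ 2 + size Y × edges G (insert (insert Y b) c) ≡ 3
  insert-edge Y {b} {c} indep b∉Y c∉Y b≢c b¹ c¹ c~b =
    trans (size-insert (insert Y b) c c∉Yb) (cong suc (size-insert Y b b∉Y)) ,
    (begin
      edges G (insert (insert Y b) c)
        ≡⟨ edges-insert G (insert Y b) c c∉Yb ⟩
      nbrs G (insert Y b) c + edges G (insert Y b)
        ≡⟨ cong₂ _+_ (nbrs-insert G Y b c b∉Y) (edges-insert G Y b b∉Y) ⟩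
      ⟦ adj G c b ⟧ + nbrs G Y c + (nbrs G Y b + edges G Y)
        ≡⟨ cong₂ _+_ (cong₂ _+_ (cong ⟦_⟧ c~b) c¹) (cong₂ _+_ b¹ (independent⇒edgeless G Y indep)) ⟩
      3 ∎)
    where
    open ≡-Reasoning
    c∉Yb : insert Y b c ≡ false
    c∉Yb = trans (insert-other Y (b≢c ∘ ≡-sym)) c∉Y

  independent-remove : ∀ {X} i → Independent G X → Independent G (remove X i)
  independent-remove {X} i indep u v u∈ v∈ =
    let _ , u∈X = ∈-remove X u∈ ; _ , v∈X = ∈-remove X v∈ in indep u v u∈X v∈X

  -- Once `i` is dropped, `b` and `c` have no neighbour left in the set, since `i` was the only one,
  -- and they are not adjacent to each other.
  swap-private : ∀ X → Independent G X → (p : PrivatePair X) → let open PrivatePair p in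
    adj G c b ≡ false →
    Independent G (insert (insert (remove X i) b) c) ×
    size (insert (insert (remove X i) b) c) ≡ suc (size X)
  swap-private X indep p c≁b =
    independent-insert G
      (independent-insert G (independent-remove i indep) (alone b¹ b~i))
      c-alone ,
    (begin
      size (insert (insert (remove X i) b) c)
        ≡⟨ size-insert _ c (trans (insert-other (remove X i) (b≢c ∘ ≡-sym)) (outside c∉X)) ⟩
      suc (size (insert (remove X i) b))
        ≡⟨ cong suc (size-insert _ b (outside b∉X)) ⟩
      suc (suc (size (remove X i)))
        ≡⟨ cong suc (size-remove X i i∈X) ⟩
      suc (size X) ∎)
    where
    open PrivatePair p
    open ≡-Reasoning
    outside : ∀ {v} → X v ≡ false → remove X i v ≡ false
    outside {v} v∉X = trans (remove-other X λ { refl → true≢false i∈X v∉X }) v∉X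
    alone : ∀ {v} → nbrs G X v ≡ 1 → adj G v i ≡ true →
      ∀ j → remove X i j ≡ true → adj G v j ≡ false
    alone v¹ v~i j j∈ = let j≢i , j∈X = ∈-remove X j∈ in
      ≢-true λ v~j → j≢i (≡-sym (unique-nbr G X v¹ v~i i∈X v~j j∈X))
    c-alone : ∀ j → insert (remove X i) b j ≡ true → adj G c j ≡ false
    c-alone j j∈ with ∈-insert (remove X i) j∈
    ... | inj₁ refl = c≁b
    ... | inj₂ j∈X  = alone c¹ c~i j j∈X

  order≤5*dominating : ∀ X → Dominates G regular X ∅ → n ≤ 5 * size X
  order≤5*dominating X dom = begin
    n                                               ≡⟨ trans (sum-const n 1) (*-identityʳ n) ⟨
    sumFin n (const 1)                              ≤⟨ sum-mono n covered ⟩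
    sumFin n (λ v → ⟦ X v ⟧ + nbrs G X v)           ≡⟨ sum-+ n _ _ ⟩
    size X + sumFin n (nbrs G X)                    ≡⟨ cong (size X +_) (sum-nbrs G regular X) ⟩
    5 * size X                                      ∎
    where
    open ≤-Reasoning
    covered : ∀ v → 1 ≤ ⟦ X v ⟧ + nbrs G X v
    covered v with X v in v∈
    ... | true  = s≤s z≤n
    ... | false = dom v v∈ refl

  another : ∀ X i → 2 ≤ size X → ∃ λ j → X j ≡ true × i ≢ j
  another X i 2≤x with two-witnesses n X 2≤x
  ... | j , k , j≢k , j∈X , k∈X with i ≟ j
  ...   | yes refl = k , k∈X , j≢k
  ...   | no i≢j   = j , j∈X , i≢j

  module _ (q : ℕ) (n≡4q : n ≡ 4 * q) where

    -- There are 4 (r + 1) edges missing. Adding b and c, which form a triangle with i, touches 5 more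
    -- edges, and dropping a vertex of X loses 4; this corrects the residue modulo 3 before filling by threes.
    half-touched-triangle : ∀ r X → Independent G X → Dominates G regular X ∅ → size X + suc r ≡ q →
      (p : PrivatePair X) → let open PrivatePair p in adj G c b ≡ true → HalfTouched G regular
    half-touched-triangle r X indep dom eq p c~b = by-residue (mod-three (suc r)) missing
      where
      open PrivatePair p
      e≡0 : edges G X ≡ 0
      e≡0 = independent⇒edgeless G X indep

      missing : 4 * size X + 4 * suc r ≡ n
      missing = trans (≡-sym (*-distribˡ-+ 4 (size X) (suc r))) (trans (cong (4 *_) eq) (≡-sym n≡4q))

      -- `missing` and n ≤ 5|X| give |X| ≥ 4(r + 1). The bound provides a second vertex `j` of `X`
      -- and the inequality |Z| = 5 ≤ |X| + 1 below.
      4≤x : 4 ≤ size X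
      4≤x = ≤-trans (*-monoʳ-≤ 4 (s≤s z≤n)) (+-cancelˡ-≤ (4 * size X) (4 * suc r) (size X)
        (≤-trans (≤-reflexive missing) (≤-trans (order≤5*dominating X dom) (≤-reflexive (+-comm (size X) _)))))

      by-residue : ∀ {m} → ModThree m → 4 * size X + 4 * m ≡ n → HalfTouched G regular
      by-residue (3k k) total = fill-by-threes G regular (4 * k) X ∅ dom
        (≤-trans (≤-reflexive (size-∅ n)) z≤n)
        (begin
          4 * size X + 3 * (4 * k)  ≡⟨ reorder (size X) k ⟩
          4 * size X + 4 * (3 * k)  ≡⟨ total ⟩
          n                         ≡⟨ +-identityʳ n ⟨
          n + 0                     ≡⟨ cong (n +_) e≡0 ⟨
          n + edges G X             ∎)
        where
        open ≡-Reasoning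
        reorder : ∀ x k → 4 * x + 3 * (4 * k) ≡ 4 * x + 4 * (3 * k)
        reorder = solve-∀
      -- 12k + 8 edges are missing; the triangle touches 5 more and leaves 3(4k + 1).
      by-residue (3k+2 k) total =
        let |Xbc| , eXbc = insert-edge X indep b∉X c∉X b≢c b¹ c¹ c~b in
        fill-by-threes G regular (4 * k + 1) (insert (insert X b) c) ∅
          (dominates-insert G regular (trans (insert-other X (b≢c ∘ ≡-sym)) c∉X) (dominates-insert G regular b∉X dom))
          (≤-trans (≤-reflexive (size-∅ n)) z≤n)
          (begin
            4 * size (insert (insert X b) c) + 3 * (4 * k + 1)
              ≡⟨ cong (λ s → 4 * s + 3 * (4 * k + 1)) |Xbc| ⟩
            4 * (2 + size X) + 3 * (4 * k + 1)
              ≡⟨ reorder (size X) k ⟩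
            4 * size X + 4 * (3 * k + 2) + 3
              ≡⟨ cong₂ _+_ total (≡-sym eXbc) ⟩
            n + edges G (insert (insert X b) c) ∎)
        where
        open ≡-Reasoning
        reorder : ∀ x k → 4 * (2 + x) + 3 * (4 * k + 1) ≡ 4 * x + 4 * (3 * k + 2) + 3
        reorder = solve-∀
      -- 12k + 4 edges are missing; dropping `j` makes this 12k + 8, and the triangle again leaves
      -- 3(4k + 1). As `j` differs from `i`, both `b` and `c` keep `i` as their only neighbour.
      by-residue (3k+1 k) total with another X i (≤-trans (s≤s (s≤s z≤n)) 4≤x)
      ... | j , j∈X , i≢j =
        let |Ybc| , eYbc = insert-edge Y (independent-remove j indep) (outside b∉X) (outside c∉X) b≢c
                             (still-private b¹ b~i) (still-private c¹ c~i) c~b in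
        fill-by-threes G regular (4 * k + 1) (insert (insert Y b) c) Z
          (dominates-insert G regular (trans (insert-other Y (b≢c ∘ ≡-sym)) (outside c∉X))
            (dominates-insert G regular (outside b∉X) Y-dominates))
          (Z≤ (trans |Ybc| (cong suc |Y|)))
          (begin
            4 * size (insert (insert Y b) c) + 3 * (4 * k + 1)
              ≡⟨ cong (λ s → 4 * s + 3 * (4 * k + 1)) (trans |Ybc| (cong suc |Y|)) ⟩
            4 * suc (size X) + 3 * (4 * k + 1)
              ≡⟨ reorder (size X) k ⟩
            4 * size X + 4 * (3 * k + 1) + 3
              ≡⟨ cong₂ _+_ total (≡-sym eYbc) ⟩
            n + edges G (insert (insert Y b) c) ∎)
        where
        open ≡-Reasoning
        Y Z : Fin n → Bool
        Y = remove X j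
        -- Every vertex that loses its only neighbour in X when j is dropped lies in Z.
        Z = insert (adj G j) j
        |Y| : suc (size Y) ≡ size X
        |Y| = size-remove X j j∈X
        |Z| : size Z ≡ 5
        |Z| = trans (size-insert (adj G j) j (irrefl G j)) (cong suc (degree-4 G regular j))
        Z≤ : ∀ {s} → s ≡ suc (size X) → size Z ≤ s
        Z≤ eq = ≤-trans (≤-reflexive |Z|) (≤-trans (s≤s 4≤x) (≤-reflexive (≡-sym eq)))
        outside : ∀ {v} → X v ≡ false → Y v ≡ false
        outside {v} v∉X = trans (remove-other X λ { refl → true≢false j∈X v∉X }) v∉X
        still-private : ∀ {v} → nbrs G X v ≡ 1 → adj G v i ≡ true → nbrs G Y v ≡ 1
        still-private {v} v¹ v~i = trans
          (cong (λ a → ⟦ a ⟧ + nbrs G Y v) (≡-sym (≢-true λ v~j → i≢j (unique-nbr G X v¹ v~i i∈X v~j j∈X))))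
          (trans (nbrs-remove G X j v j∈X) v¹)
        Y-dominates : Dominates G regular Y Z
        Y-dominates v v∉Y v∉Z =
          let v≢j , j≁v = ∉-insert (adj G j) v∉Z in
          ≤-trans (dom v (∉-remove X v≢j v∉Y) refl)
            (≤-reflexive (trans (≡-sym (nbrs-remove G X j v j∈X))
              (cong (λ a → ⟦ a ⟧ + nbrs G Y v) (trans (sym G v j) j≁v))))
        reorder : ∀ x k → 4 * suc x + 3 * (4 * k + 1) ≡ 4 * x + 4 * (3 * k + 1) + 3
        reorder = solve-∀

    -- Recursion on the shortfall from `q`, since an independent set of `q` vertices touches 4q = n
    -- edges. A smaller set that cannot be extended has a private pair: if `b` and `c` are not
    -- adjacent, the exchange enlarges the set, and otherwise the triangle finishes.
    half-touched-from : ∀ r X → Independent G X → size X + r ≡ q → HalfTouched G regular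
    half-touched-from zero X indep eq = X , (begin
      4 * size X     ≡⟨ cong (4 *_) (trans (≡-sym (+-identityʳ _)) eq) ⟩
      4 * q          ≡⟨ n≡4q ⟨
      n              ≡⟨ +-identityʳ n ⟨
      n + 0          ≡⟨ cong (n +_) (independent⇒edgeless G X indep) ⟨
      n + edges G X  ∎)
      where open ≡-Reasoning
    half-touched-from (suc r) X indep eq with extend-or-dominates G regular q n≡4q X indep
    ... | inj₁ (v , indep′ , |Xv|) = half-touched-from r (insert X v) indep′
      (trans (cong (_+ r) |Xv|) (trans (≡-sym (+-suc (size X) r)) eq))
    ... | inj₂ dom with private-pair X indep dom 4x<n
      where
      open ≤-Reasoning
      4x<n : 4 * size X < n
      4x<n = begin-strict
        4 * size X            <⟨ *-monoʳ-< 4 (m<m+n (size X) (s≤s z≤n)) ⟩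
        4 * (size X + suc r)  ≡⟨ trans (cong (4 *_) eq) (≡-sym n≡4q) ⟩
        n                     ∎
    ...   | p with adj G (PrivatePair.c p) (PrivatePair.b p) in c~b
    ...     | true  = half-touched-triangle r X indep dom eq p c~b
    ...     | false = let indep′ , |X′| = swap-private X indep p c~b in
      half-touched-from r _ indep′
        (trans (cong (_+ r) |X′|) (trans (≡-sym (+-suc (size X) r)) eq))

    half-touched : HalfTouched G regular
    half-touched = half-touched-from q ∅ (λ _ _ ()) (cong (_+ q) (size-∅ n))

    -- The edges inside the complement of `X` are those that `X` does not touch, 2n - n of them.
    half-induced : ∃ λ X → edges G X ≡ n
    half-induced = let X , 4x≡n+e = half-touched in not ∘ X , untouched X 4x≡n+e
      where
      untouched : ∀ X → 4 * size X ≡ n + edges G X → edges G (not ∘ X) ≡ n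
      untouched X 4x≡n+e = +-cancelʳ-≡ n _ _ (begin
        edges G (not ∘ X) + n                      ≡⟨ cong (edges G (not ∘ X) +_) touched ⟨
        edges G (not ∘ X) + (edges G X + cutEdges G regular X) ≡⟨ edge-partition G regular X ⟩
        2 * n                                      ≡⟨ cong (n +_) (+-identityʳ n) ⟩
        n + n                                      ∎)
        where
        open ≡-Reasoning
        regroup : ∀ e c → e + c + e ≡ c + 2 * e
        regroup = solve-∀
        touched : edges G X + cutEdges G regular X ≡ n
        touched = +-cancelʳ-≡ (edges G X) _ _
          (trans (regroup (edges G X) _) (trans (cut-formula G regular X) 4x≡n+e))

-- Ramsey and Kővári–Sós–Turán

-- The `suc` grants a slack of one, which pays for the chosen vertex in `ramsey` and for a vertex
-- not being joined to itself in `degreeInto-both`.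
≤-pigeonhole : ∀ {k p q} → 2 * k ≤ suc (p + q) → k ≤ p ⊎ k ≤ q
≤-pigeonhole {k} {p} {q} 2k≤ with k ≤? p
... | yes k≤p = inj₁ k≤p
... | no k≰p  = inj₂ (+-cancelˡ-≤ k k q (begin
  k + k      ≡⟨ cong (k +_) (+-identityʳ k) ⟨
  2 * k      ≤⟨ 2k≤ ⟩
  suc p + q  ≤⟨ +-monoˡ-≤ q (≰⇒> k≰p) ⟩
  k + q      ∎))
  where open ≤-Reasoning

module _ {A : Set} where

  length-filter-∁ : ∀ {P : A → Set} (P? : Decidable P) xs →
    length (filter P? xs) + length (filter (¬? ∘ P?) xs) ≡ length xs
  length-filter-∁ P? []       = refl
  length-filter-∁ P? (x ∷ xs) with P? x
  ... | yes _ = cong suc (length-filter-∁ P? xs)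
  ... | no _  = trans (+-suc _ _) (cong suc (length-filter-∁ P? xs))

  AllPairs-resp-⊆ : ∀ {R : A → A → Set} {xs ys} → xs ⊆ ys → AllPairs R ys → AllPairs R xs
  AllPairs-resp-⊆ []        []       = []
  AllPairs-resp-⊆ (y ∷ʳ τ)   (_ ∷ ps) = AllPairs-resp-⊆ τ ps
  AllPairs-resp-⊆ (refl ∷ τ) (p ∷ ps) = All-resp-⊆ τ p ∷ AllPairs-resp-⊆ τ ps

  AllPairs-lookup : ∀ {R : A → A → Set} → (∀ {x y} → R x y → R y x) →
    ∀ {xs} → AllPairs R xs → ∀ {i j} → i ≢ j → R (lookup xs i) (lookup xs j)
  AllPairs-lookup R-sym {x ∷ xs} (p ∷ ps) {zero}  {zero}  i≢j = contradiction refl i≢j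
  AllPairs-lookup R-sym {x ∷ xs} (p ∷ ps) {zero}  {suc j} i≢j = All.lookup p (∈-lookup j)
  AllPairs-lookup R-sym {x ∷ xs} (p ∷ ps) {suc i} {zero}  i≢j = R-sym (All.lookup p (∈-lookup i))
  AllPairs-lookup R-sym {x ∷ xs} (p ∷ ps) {suc i} {suc j} i≢j =
    AllPairs-lookup R-sym ps (i≢j ∘ cong suc)

length-filter-tabulate : ∀ {A : Set} {P : A → Set} (P? : Decidable P) n (f : Fin n → A) →
  length (filter P? (tabulate f)) ≡ sumFin n (λ i → ⟦ ⌊ P? (f i) ⌋ ⟧)
length-filter-tabulate P? zero    f = refl
length-filter-tabulate P? (suc n) f with P? (f zero)
... | yes _ = cong suc (length-filter-tabulate P? n (f ∘ suc))
... | no _  = length-filter-tabulate P? n (f ∘ suc)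

1≤2^ : ∀ k → 1 ≤ 2 ^ k
1≤2^ k = m^n>0 2 k

infix 4 _≟ᶜ_
_≟ᶜ_ : (c d : Colour) → Dec (c ≡ d)
R ≟ᶜ R = yes refl
R ≟ᶜ B = no λ ()
B ≟ᶜ R = no λ ()
B ≟ᶜ B = yes refl

≢R⇒B : ∀ {c} → c ≢ R → c ≡ B
≢R⇒B {R} c≢R = contradiction refl c≢R
≢R⇒B {B} c≢R = refl

module _ {N : ℕ} (φ : Colouring N) where

  -- Distinctness is part of an edge, so cliques have no repeated entries and complete pairs are
  -- disjoint; the injectivity of the embedding comes from this.
  Edge : Colour → Fin N → Fin N → Set
  Edge c u v = u ≢ v × col φ u v ≡ c

  edge? : ∀ c u v → Dec (Edge c u v)
  edge? c u v = ¬? (u ≟ v) ×-dec (col φ u v ≟ᶜ c)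

  edge-sym : ∀ {c u v} → Edge c u v → Edge c v u
  edge-sym {u = u} {v} (u≢v , uv) = u≢v ∘ ≡-sym , trans (colSym φ v u) uv

  Clique : Colour → List (Fin N) → Set
  Clique c = AllPairs (Edge c)

  Complete : Colour → List (Fin N) → List (Fin N) → Set
  Complete c xs ys = All (λ x → All (Edge c x) ys) xs

  select : ℕ → ℕ → Colour → ℕ
  select a b R = a
  select a b B = b

  -- The head `x` splits the other vertices by the colour of their edge to `x`, and one class keeps
  -- at least half of the required power of two. Recursion in that class lowers the demand for its
  -- colour by one, and `x` extends a clique found in that colour.
  ramsey : ∀ a b xs → AllPairs _≢_ xs → 2 ^ (a + b) ≤ length xs →
    ∃₂ λ c ys → ys ⊆ xs × length ys ≡ select a b c × Clique c ys
  ramsey zero    b       xs       xs! big = R , [] , minimum xs , refl , []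
  ramsey (suc a) zero    xs       xs! big = B , [] , minimum xs , refl , []
  ramsey (suc a) (suc b) []       xs! big = contradiction (≤-trans (1≤2^ (suc a + suc b)) big) λ ()
  ramsey (suc a) (suc b) (x ∷ xs) (x∉xs ∷ xs!) big
    with ≤-pigeonhole {2 ^ (a + suc b)} (≤-trans big (≤-reflexive (cong suc (≡-sym (length-filter-∁ (λ y → col φ x y ≟ᶜ R) xs)))))
  ... | inj₁ many with ramsey a (suc b) (filter (λ y → col φ x y ≟ᶜ R) xs) (AllPairs.filter⁺ _ xs!) many
  ...   | R , ys , ys⊆ , |ys| , clique =
          R , x ∷ ys , refl ∷ ⊆-trans ys⊆ (filter-⊆ _ xs) , cong suc |ys| ,
          All.zip (All-resp-⊆ (⊆-trans ys⊆ (filter-⊆ _ xs)) x∉xs , All-resp-⊆ ys⊆ (all-filter _ xs)) ∷ clique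
  ...   | B , ys , ys⊆ , |ys| , clique =
          B , ys , x ∷ʳ ⊆-trans ys⊆ (filter-⊆ _ xs) , |ys| , clique
  ramsey (suc a) (suc b) (x ∷ xs) (x∉xs ∷ xs!) big
      | inj₂ many with ramsey (suc a) b (filter (¬? ∘ (λ y → col φ x y ≟ᶜ R)) xs) (AllPairs.filter⁺ _ xs!)
                         (subst (λ k → 2 ^ k ≤ length (filter (¬? ∘ (λ y → col φ x y ≟ᶜ R)) xs)) (+-suc a b) many)
  ...   | R , ys , ys⊆ , |ys| , clique =
          R , ys , x ∷ʳ ⊆-trans ys⊆ (filter-⊆ _ xs) , |ys| , clique
  ...   | B , ys , ys⊆ , |ys| , clique =
          B , x ∷ ys , refl ∷ ⊆-trans ys⊆ (filter-⊆ _ xs) , cong suc |ys| ,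
          All.zip (All-resp-⊆ (⊆-trans ys⊆ (filter-⊆ _ xs)) x∉xs ,
                   All.map ≢R⇒B (All-resp-⊆ ys⊆ (all-filter _ xs))) ∷ clique

  ramsey-diagonal : ∀ s xs → AllPairs _≢_ xs → 2 ^ (s + s) ≤ length xs →
    ∃₂ λ c ys → ys ⊆ xs × length ys ≡ s × Clique c ys
  ramsey-diagonal s xs xs! big with ramsey s s xs xs! big
  ... | R , found = R , found
  ... | B , found = B , found

  degreeInto : Colour → List (Fin N) → Fin N → ℕ
  degreeInto c xs y = length (filter (λ x → edge? c x y) xs)

  -- Kővári–Sós–Turán for constantly many xs: each step halves the ys according to adjacency to the head of xs.
  complete-pair : ∀ c xs ys s t → 1 ≤ t → 2 ^ length xs * t ≤ length ys →
    All (λ y → s ≤ degreeInto c xs y) ys →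
    ∃₂ λ xs′ ys′ → xs′ ⊆ xs × ys′ ⊆ ys × length xs′ ≡ s × t ≤ length ys′ × Complete c xs′ ys′
  complete-pair c xs ys zero t 1≤t big deg =
    [] , ys , minimum xs , ⊆-refl , refl ,
    ≤-trans (m≤n*m t (2 ^ length xs) {{m^n≢0 2 (length xs)}}) big , []
  -- `xs` cannot run out early: `1 ≤ t` leaves some y, which would need `suc s` neighbours in the
  -- empty list.
  complete-pair c [] [] (suc s) t 1≤t big deg =
    contradiction (≤-trans 1≤t (≤-trans (≤-reflexive (≡-sym (+-identityʳ t))) big)) λ ()
  complete-pair c [] (y ∷ ys) (suc s) t 1≤t big (() ∷ _)
  complete-pair c (x ∷ xs) ys (suc s) t 1≤t big deg
    with ≤-pigeonhole {2 ^ length xs * t} (m≤n⇒m≤1+n (≤-trans (≤-reflexive (≡-sym (*-assoc 2 (2 ^ length xs) t)))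
           (≤-trans big (≤-reflexive (≡-sym (length-filter-∁ (edge? c x) ys))))))
  -- Every kept y is joined to `x`, so `x` is taken and one neighbour fewer is demanded from the
  -- rest of `xs`.
  ... | inj₁ many =
    let xs′ , ys′ , xs′⊆ , ys′⊆ , |xs′| , |ys′| , complete =
          complete-pair c xs (filter (edge? c x) ys) s t 1≤t many
            (All.zipWith joined (all-filter (edge? c x) ys , All-resp-⊆ (filter-⊆ _ ys) deg))
    in x ∷ xs′ , ys′ , refl ∷ xs′⊆ , ⊆-trans ys′⊆ (filter-⊆ _ ys) , cong suc |xs′| , |ys′| ,
       All-resp-⊆ ys′⊆ (all-filter (edge? c x) ys) ∷ complete
    where
    joined : ∀ {y} → Edge c x y × suc s ≤ degreeInto c (x ∷ xs) y → s ≤ degreeInto c xs y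
    joined {y} (xy , s<) = ≤-pred (≤-trans s< (≤-reflexive (cong length (filter-accept (λ x → edge? c x y) xy))))
  -- No kept y is joined to `x`, so dropping `x` takes no neighbour away.
  ... | inj₂ many =
    let xs′ , ys′ , xs′⊆ , ys′⊆ , |xs′| , |ys′| , complete =
          complete-pair c xs (filter (¬? ∘ edge? c x) ys) (suc s) t 1≤t many
            (All.zipWith separate (all-filter (¬? ∘ edge? c x) ys , All-resp-⊆ (filter-⊆ _ ys) deg))
    in xs′ , ys′ , x ∷ʳ xs′⊆ , ⊆-trans ys′⊆ (filter-⊆ _ ys) , |xs′| , |ys′| , complete
    where
    separate : ∀ {y} → ¬ Edge c x y × suc s ≤ degreeInto c (x ∷ xs) y → suc s ≤ degreeInto c xs y
    separate {y} (¬xy , s<) = ≤-trans s< (≤-reflexive (cong length (filter-reject (λ x → edge? c x y) ¬xy)))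

-- Hubs, popular vertices and mixed patterns

2nC2 : ∀ N → 2 * (N C 2) + N ≡ N * N
2nC2 zero    = refl
2nC2 (suc N) = begin
  2 * (suc N C 2) + suc N       ≡⟨ cong (λ k → 2 * k + suc N) (nCk+nC[k+1]≡[n+1]C[k+1] N 1) ⟨
  2 * (N C 1 + N C 2) + suc N   ≡⟨ cong (λ k → 2 * (k + N C 2) + suc N) (nC1≡n N) ⟩
  2 * (N + N C 2) + suc N       ≡⟨ regroup N (N C 2) ⟩
  (2 * (N C 2) + N) + (2 * N + 1) ≡⟨ cong (_+ (2 * N + 1)) (2nC2 N) ⟩
  N * N + (2 * N + 1)           ≡⟨ square N ⟩
  suc N * suc N                 ∎
  where
  open ≡-Reasoning
  regroup : ∀ n k → 2 * (n + k) + suc n ≡ (2 * k + n) + (2 * n + 1)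
  regroup = solve-∀
  square : ∀ n → n * n + (2 * n + 1) ≡ suc n * suc n
  square = solve-∀

square≤halfPairs : ∀ N → N * N ≤ 4 * ((N C 2) / 2) + 2 + N
square≤halfPairs N = begin
  N * N                                    ≡⟨ 2nC2 N ⟨
  2 * (N C 2) + N                          ≡⟨ cong (λ k → 2 * k + N) (m≡m%n+[m/n]*n (N C 2) 2) ⟩
  2 * ((N C 2) % 2 + (N C 2) / 2 * 2) + N  ≤⟨ +-monoˡ-≤ N (*-monoʳ-≤ 2 (+-monoˡ-≤ _ (≤-pred (m%n<n (N C 2) 2)))) ⟩
  2 * (1 + (N C 2) / 2 * 2) + N            ≡⟨ regroup N ((N C 2) / 2) ⟩
  4 * ((N C 2) / 2) + 2 + N                ∎
  where
  open ≤-Reasoning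
  regroup : ∀ n h → 2 * (1 + h * 2) + n ≡ 4 * h + 2 + n
  regroup = solve-∀

-- The first summands ensure enough hubs for Ramsey's theorem, the last one enough popular vertices for complete-pair.
patternThreshold : ℕ → ℕ
patternThreshold s = 4 * 2 ^ (8 * s + 8 * s) + 4 + 8 * (2 ^ (8 * s) * 2 ^ (s + s))

4≤patternThreshold : ∀ s → 4 ≤ patternThreshold s
4≤patternThreshold s = ≤-trans (m≤n+m 4 (4 * 2 ^ (8 * s + 8 * s))) (m≤m+n _ _)

module _ {N : ℕ} (φ : Colouring N) where

  numOf : Colour → ℕ
  numOf R = numR φ
  numOf B = numB φ

  degree-in-colour : Colour → Fin N → ℕ
  degree-in-colour c v = length (filter (edge? φ c v) (allFin N))

  sum-degrees : ∀ c → sumFin N (degree-in-colour c) ≡ 2 * numOf c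
  sum-degrees c = begin
    sumFin N (degree-in-colour c)
      ≡⟨ sum-cong N (λ v → length-filter-tabulate (edge? φ c v) N (λ w → w)) ⟩
    sumFin N (λ v → sumFin N (weight v))
      ≡⟨ handshake N weight loop ⟨
    pairSum N (λ u v → weight u v + weight v u)
      ≡⟨ pairSum-+ N weight (λ u v → weight v u) ⟩
    pairSum N weight + pairSum N (λ u v → weight v u)
      ≡⟨ cong (pairSum N weight +_) (pairSum-cong N (λ u v _ → symmetric u v)) ⟩
    pairSum N weight + pairSum N weight
      ≡⟨ cong (pairSum N weight +_) (+-identityʳ _) ⟨
    2 * pairSum N weight
      ≡⟨ cong (2 *_) (number c) ⟩
    2 * numOf c ∎
    where
    open ≡-Reasoning
    weight : Fin N → Fin N → ℕ
    weight u v = ⟦ ⌊ edge? φ c u v ⌋ ⟧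
    loop : ∀ u → weight u u ≡ 0
    loop u = cong ⟦_⟧ (⌊⌋-no (edge? φ c u u) λ { (u≢u , _) → u≢u refl })
    symmetric : ∀ u v → weight v u ≡ weight u v
    symmetric u v with edge? φ c u v
    ... | yes uv = cong ⟦_⟧ (⌊⌋-yes (edge? φ c v u) (edge-sym φ uv))
    ... | no ¬uv = cong ⟦_⟧ (⌊⌋-no (edge? φ c v u) (¬uv ∘ edge-sym φ))
    number : ∀ d → pairSum N (λ u v → ⟦ ⌊ edge? φ d u v ⌋ ⟧) ≡ numOf d
    number R = trans (pairSum-cong N pointwise) (≡-sym (countPairs≡pairSum N _))
      where
      pointwise : ∀ u v → u ≢ v → ⟦ ⌊ edge? φ R u v ⌋ ⟧ ≡ ⟦ isR (col φ u v) ⟧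
      pointwise u v u≢v with u ≟ v | col φ u v
      ... | yes u≡v | _ = contradiction u≡v u≢v
      ... | no _    | R = refl
      ... | no _    | B = refl
    number B = trans (pairSum-cong N pointwise) (≡-sym (countPairs≡pairSum N _))
      where
      pointwise : ∀ u v → u ≢ v → ⟦ ⌊ edge? φ B u v ⌋ ⟧ ≡ ⟦ isB (col φ u v) ⟧
      pointwise u v u≢v with u ≟ v | col φ u v
      ... | yes u≡v | _ = contradiction u≡v u≢v
      ... | no _    | R = refl
      ... | no _    | B = refl

  hub? : ∀ c v → Dec (N ≤ 4 * degree-in-colour c v)
  hub? c v = N ≤? 4 * degree-in-colour c v

  hubs : Colour → List (Fin N)
  hubs c = filter (hub? c) (allFin N)

  -- Other vertices have degree below N/4 and hubs at most N, so four times the degree sum is at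
  -- most N² + 4Nh, with h the number of hubs. By the hypothesis on `numOf c` it is at least 2N² -
  -- 2N - 4. For h < m the two bounds conflict.
  many-hubs : ∀ c m → 4 * m + 4 ≤ N → (N C 2) / 2 ≤ numOf c → m ≤ length (hubs c)
  many-hubs c m N-big half≤ = ≮⇒≥ λ h<m → <-irrefl refl (begin-strict
    2 * (N * N)                            ≤⟨ *-monoʳ-≤ 2 (square≤halfPairs N) ⟩
    2 * (4 * ((N C 2) / 2) + 2 + N)        ≡⟨ regroup ((N C 2) / 2) N ⟩
    4 * (2 * ((N C 2) / 2)) + (2 * N + 4)  ≤⟨ +-monoˡ-≤ (2 * N + 4) (*-monoʳ-≤ 4 (*-monoʳ-≤ 2 half≤)) ⟩
    4 * (2 * numOf c) + (2 * N + 4)        ≡⟨ cong (λ k → 4 * k + (2 * N + 4)) (sum-degrees c) ⟨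
    4 * sumFin N (degree-in-colour c) + (2 * N + 4) ≤⟨ +-monoˡ-≤ (2 * N + 4) degrees ⟩
    N * N + 4 * N * h + (2 * N + 4)        ≡⟨ +-assoc (N * N) _ _ ⟩
    N * N + (4 * N * h + (2 * N + 4))
      ≤⟨ +-monoʳ-≤ (N * N) (+-monoʳ-≤ (4 * N * h) (+-monoʳ-≤ (2 * N) (≤-trans (m≤n+m 4 (4 * m)) N-big))) ⟩
    N * N + (4 * N * h + (2 * N + N))      ≡⟨ cong (N * N +_) (factor N h) ⟩
    N * N + N * (4 * h + 3)                <⟨ +-monoʳ-< (N * N) (*-monoʳ-< N {{N≢0}} (4h+3<N h<m)) ⟩
    N * N + N * N                          ≡⟨ cong (N * N +_) (+-identityʳ (N * N)) ⟨
    2 * (N * N)                            ∎)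
    where
    open ≤-Reasoning
    h : ℕ
    h = length (hubs c)
    N≢0 : NonZero N
    N≢0 = >-nonZero (≤-trans (s≤s z≤n) (≤-trans (m≤n+m 4 (4 * m)) N-big))
    4h+3<N : h < m → 4 * h + 3 < N
    4h+3<N h<m = ≤-trans (≤-reflexive (≡-sym (+-suc (4 * h) 3)))
      (≤-trans (+-monoˡ-≤ 4 (*-monoʳ-≤ 4 (<⇒≤ h<m))) N-big)
    regroup : ∀ k n → 2 * (4 * k + 2 + n) ≡ 4 * (2 * k) + (2 * n + 4)
    regroup = solve-∀
    factor : ∀ n h → 4 * n * h + (2 * n + n) ≡ n * (4 * h + 3)
    factor = solve-∀
    each : ∀ v → 4 * degree-in-colour c v ≤ N + 4 * N * ⟦ ⌊ hub? c v ⌋ ⟧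
    each v with hub? c v
    ... | no ¬hub = ≤-trans (<⇒≤ (≰⇒> ¬hub)) (m≤m+n N _)
    ... | yes _   = ≤-trans (*-monoʳ-≤ 4 (≤-trans (length-filter (edge? φ c v) (allFin N)) (≤-reflexive (length-tabulate {n = N} (λ w → w)))))
                      (≤-trans (≤-reflexive (≡-sym (*-identityʳ (4 * N)))) (m≤n+m _ N))
    degrees : 4 * sumFin N (degree-in-colour c) ≤ N * N + 4 * N * h
    degrees = begin
      4 * sumFin N (degree-in-colour c)                     ≡⟨ sum-* N 4 _ ⟨
      sumFin N (λ v → 4 * degree-in-colour c v)             ≤⟨ sum-mono N each ⟩
      sumFin N (λ v → N + 4 * N * ⟦ ⌊ hub? c v ⌋ ⟧)         ≡⟨ sum-+ N _ _ ⟩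
      sumFin N (λ _ → N) + sumFin N (λ v → 4 * N * ⟦ ⌊ hub? c v ⌋ ⟧)
        ≡⟨ cong₂ _+_ (sum-const N N) (trans (sum-* N (4 * N) _) (cong (4 * N *_) (≡-sym (length-filter-tabulate (hub? c) N (λ v → v))))) ⟩
      N * N + 4 * N * h ∎

  popular? : ∀ c s xs y → Dec (s ≤ degreeInto φ c xs y)
  popular? c s xs y = s ≤? degreeInto φ c xs y

  totalInto : Colour → List (Fin N) → List (Fin N) → ℕ
  totalInto c xs ys = sum (map (degreeInto φ c xs) ys)

  -- `totalInto` is summed over `ys`; peeling off `x` gives the summation over `xs`, the other side
  -- of the double count.
  totalInto-∷ : ∀ c x xs ys →
    totalInto c (x ∷ xs) ys ≡ length (filter (edge? φ c x) ys) + totalInto c xs ys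
  totalInto-∷ c x xs []       = refl
  totalInto-∷ c x xs (y ∷ ys) with does (edge? φ c x y)
  ... | true  = cong suc (trans (cong (degreeInto φ c xs y +_) (totalInto-∷ c x xs ys))
                  (x∙yz≈y∙xz (degreeInto φ c xs y) (length (filter (edge? φ c x) ys)) (totalInto c xs ys)))
  ... | false = trans (cong (degreeInto φ c xs y +_) (totalInto-∷ c x xs ys))
                  (x∙yz≈y∙xz (degreeInto φ c xs y) (length (filter (edge? φ c x) ys)) (totalInto c xs ys))

  totalInto-≥ : ∀ c xs ys → All (λ x → N ≤ 4 * length (filter (edge? φ c x) ys)) xs →
    length xs * N ≤ 4 * totalInto c xs ys
  totalInto-≥ c []       ys []         = z≤n
  totalInto-≥ c (x ∷ xs) ys (Nx ∷ Nxs) = begin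
    N + length xs * N                        ≤⟨ +-mono-≤ Nx (totalInto-≥ c xs ys Nxs) ⟩
    4 * length (filter (edge? φ c x) ys) + 4 * totalInto c xs ys
      ≡⟨ *-distribˡ-+ 4 (length (filter (edge? φ c x) ys)) (totalInto c xs ys) ⟨
    4 * (length (filter (edge? φ c x) ys) + totalInto c xs ys)
      ≡⟨ cong (4 *_) (totalInto-∷ c x xs ys) ⟨
    4 * totalInto c (x ∷ xs) ys              ∎
    where open ≤-Reasoning

  totalInto-≤ : ∀ c s xs ys →
    totalInto c xs ys ≤ length xs * length (filter (popular? c s xs) ys) + s * length ys
  totalInto-≤ c s xs []       = z≤n
  totalInto-≤ c s xs (y ∷ ys) with popular? c s xs y
  ... | yes pop rewrite filter-accept (popular? c s xs) {y} {ys} pop = begin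
    degreeInto φ c xs y + totalInto c xs ys
      ≤⟨ +-mono-≤ (length-filter (λ x → edge? φ c x y) xs) (totalInto-≤ c s xs ys) ⟩
    length xs + (length xs * p + s * length ys)
      ≡⟨ +-assoc (length xs) _ _ ⟨
    length xs + length xs * p + s * length ys
      ≤⟨ +-mono-≤ (≤-reflexive (≡-sym (*-suc (length xs) p))) (*-monoʳ-≤ s (n≤1+n (length ys))) ⟩
    length xs * suc p + s * suc (length ys) ∎
    where
    open ≤-Reasoning
    p = length (filter (popular? c s xs) ys)
  ... | no ¬pop rewrite filter-reject (popular? c s xs) {y} {ys} ¬pop = begin
    degreeInto φ c xs y + totalInto c xs ys
      ≤⟨ +-mono-≤ (<⇒≤ (≰⇒> ¬pop)) (totalInto-≤ c s xs ys) ⟩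
    s + (length xs * p + s * length ys)
      ≡⟨ x∙yz≈y∙xz s (length xs * p) (s * length ys) ⟩
    length xs * p + (s + s * length ys)
      ≡⟨ cong (length xs * p +_) (*-suc s (length ys)) ⟨
    length xs * p + s * suc (length ys) ∎
    where
    open ≤-Reasoning
    p = length (filter (popular? c s xs) ys)

  -- With degrees of at least N/4, the 8s hubs send out at least 2sN edges of colour `c`. Unpopular
  -- vertices receive at most sN of them together and each popular one at most 8s, so at least N/8
  -- vertices are popular.
  many-popular : ∀ c s xs → 1 ≤ s → length xs ≡ 8 * s → All (λ x → N ≤ 4 * degree-in-colour c x) xs →
    N ≤ 8 * length (filter (popular? c s xs) (allFin N))
  many-popular c s xs 1≤s |xs| hub = *-cancelˡ-≤ (4 * s) {{>-nonZero (≤-trans 1≤s (m≤n*m s 4))}} (+-cancelʳ-≤ (4 * s * N) _ _ (begin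
    4 * s * N + 4 * s * N        ≡⟨ double s N ⟩
    8 * s * N                    ≡⟨ cong (_* N) |xs| ⟨
    length xs * N                ≤⟨ totalInto-≥ c xs (allFin N) hub ⟩
    4 * totalInto c xs (allFin N) ≤⟨ *-monoʳ-≤ 4 (totalInto-≤ c s xs (allFin N)) ⟩
    4 * (length xs * p + s * length (allFin N)) ≡⟨ cong₂ (λ k l → 4 * (k * p + s * l)) |xs| (length-tabulate {n = N} (λ w → w)) ⟩
    4 * (8 * s * p + s * N)      ≡⟨ regroup s p N ⟩
    4 * s * (8 * p) + 4 * s * N  ∎))
    where
    open ≤-Reasoning
    p = length (filter (popular? c s xs) (allFin N))
    double : ∀ s n → 4 * s * n + 4 * s * n ≡ 8 * s * n
    double = solve-∀
    regroup : ∀ s p n → 4 * (8 * s * p + s * n) ≡ 4 * s * (8 * p) + 4 * s * n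
    regroup = solve-∀

  record Pattern (m : ℕ) (a b c : Colour) : Set where
    constructor pattern-of
    field
      left right   : List (Fin N)
      m≤left       : m ≤ length left
      m≤right      : m ≤ length right
      left-clique  : Clique φ a left
      right-clique : Clique φ b right
      cross        : Complete φ c left right

  -- Ramsey among the hubs of `c` gives a clique of size 8s; `many-popular` and `complete-pair` join
  -- s of its vertices completely in colour `c` to at least 2^(2s) vertices, and Ramsey once more
  -- finds a clique of size s among those. Only the cross colour is prescribed.
  pattern-with-cross : ∀ c s → 1 ≤ s → patternThreshold s ≤ N → (N C 2) / 2 ≤ numOf c →
    ∃₂ λ a b → Pattern s a b c
  pattern-with-cross c s 1≤s N-big half≤ =
    let a , xs , xs⊆ , |xs| , xs-clique = ramsey-diagonal φ (8 * s) (hubs c) (AllPairs.filter⁺ (hub? c) (allFin⁺ N))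
          (many-hubs c _ (≤-trans (m≤m+n _ _) N-big) half≤)
        popular = filter (popular? c s xs) (allFin N)
        enough  = *-cancelˡ-≤ 8 (≤-trans (≤-trans (m≤n+m _ (4 * 2 ^ (8 * s + 8 * s) + 4)) N-big)
                    (many-popular c s xs 1≤s |xs| (All-resp-⊆ xs⊆ (all-filter (hub? c) (allFin N)))))
        xs′ , ys , xs′⊆ , ys⊆ , |xs′| , |ys| , complete =
          complete-pair φ c xs popular s (2 ^ (s + s)) (1≤2^ (s + s))
            (subst (λ k → 2 ^ k * 2 ^ (s + s) ≤ length popular) (≡-sym |xs|) enough)
            (all-filter (popular? c s xs) (allFin N))
        b , ys′ , ys′⊆ , |ys′| , ys-clique =
          ramsey-diagonal φ s ys (AllPairs-resp-⊆ ys⊆ (AllPairs.filter⁺ _ (allFin⁺ N))) |ys|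
    in a , b , pattern-of xs′ ys′ (≤-reflexive (≡-sym |xs′|)) (≤-reflexive (≡-sym |ys′|))
         (AllPairs-resp-⊆ xs′⊆ xs-clique) ys-clique (All.map (All-resp-⊆ ys′⊆) complete)

  -- The entries are distinct, so `y` occurs at most once among them; the `suc` covers that
  -- occurrence.
  degreeInto-both : ∀ y xs → AllPairs _≢_ xs →
    length xs ≤ suc (degreeInto φ R xs y + degreeInto φ B xs y)
  degreeInto-both y xs xs! = go xs xs!
    where
    avoiding : ∀ xs → All (y ≢_) xs → length xs ≤ degreeInto φ R xs y + degreeInto φ B xs y
    avoiding []       []           = z≤n
    avoiding (x ∷ xs) (y≢x ∷ y∉xs) with x ≟ y | col φ x y
    ... | yes x≡y | _ = contradiction (≡-sym x≡y) y≢x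
    ... | no _    | R = s≤s (avoiding xs y∉xs)
    ... | no _    | B = ≤-trans (s≤s (avoiding xs y∉xs)) (≤-reflexive (≡-sym (+-suc _ _)))
    go : ∀ xs → AllPairs _≢_ xs → length xs ≤ suc (degreeInto φ R xs y + degreeInto φ B xs y)
    go []       []           = z≤n
    go (x ∷ xs) (x∉xs ∷ xs!) with x ≟ y | col φ x y
    ... | yes refl | _ = s≤s (avoiding xs x∉xs)
    ... | no _     | R = s≤s (go xs xs!)
    ... | no _     | B = s≤s (≤-trans (go xs xs!) (≤-reflexive (≡-sym (+-suc _ _))))

  Mixed : ℕ → Set
  Mixed m = ∃₂ λ a b → ∃ λ c → ¬ (a ≡ c × b ≡ c) × Pattern m a b c

  weaken-mixed : ∀ {m s} → m ≤ s → Mixed s → Mixed m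
  weaken-mixed m≤s (a , b , c , mixed , pattern-of xs ys |xs| |ys| xs! ys! xy) =
    a , b , c , mixed , pattern-of xs ys (≤-trans m≤s |xs|) (≤-trans m≤s |ys|) xs! ys! xy

  -- At least half of the blue clique agrees on a colour `c` in which each vertex has m neighbours
  -- in a red set of 2m vertices, so `complete-pair` applies. The two sides stay red and blue, which
  -- makes the pattern mixed for either `c`.
  mixed-from-cliques : ∀ m → 1 ≤ m → ∀ xs ys → 2 * m ≤ length xs → 2 * (2 ^ (2 * m) * m) ≤ length ys →
    Clique φ R xs → Clique φ B ys → Mixed m
  mixed-from-cliques m 1≤m xs ys |xs| |ys| red blue =
    case ≤-pigeonhole (m≤n⇒m≤1+n (≤-trans |ys| (≤-reflexive (≡-sym (length-filter-∁ (popular? R m xs′) ys))))) of λ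
      { (inj₁ many) → finish R (filter-⊆ _ ys) many (all-filter (popular? R m xs′) ys)
      ; (inj₂ many) → finish B (filter-⊆ _ ys) many (All.map popular-B (all-filter (¬? ∘ popular? R m xs′) ys))
      }
    where
    -- Exactly 2m vertices are kept, because `complete-pair` demands a factor 2 ^ |xs′|.
    xs′ : List (Fin N)
    xs′ = take (2 * m) xs
    |xs′| : length xs′ ≡ 2 * m
    |xs′| = trans (length-take (2 * m) xs) (m≤n⇒m⊓n≡m |xs|)
    red′ : Clique φ R xs′
    red′ = AllPairs.take⁺ (2 * m) red
    popular-B : ∀ {y} → ¬ (m ≤ degreeInto φ R xs′ y) → m ≤ degreeInto φ B xs′ y
    popular-B {y} few-R with ≤-pigeonhole (≤-trans (≤-reflexive (≡-sym |xs′|)) (degreeInto-both y xs′ (AllPairs.map proj₁ red′)))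
    ... | inj₁ many-R = contradiction many-R few-R
    ... | inj₂ many-B = many-B
    finish : ∀ c {zs} → zs ⊆ ys → 2 ^ (2 * m) * m ≤ length zs →
      All (λ y → m ≤ degreeInto φ c xs′ y) zs → Mixed m
    finish c {zs} zs⊆ many popular =
      let us , vs , us⊆ , vs⊆ , |us| , |vs| , complete = complete-pair φ c xs′ zs m m 1≤m
            (subst (λ k → 2 ^ k * m ≤ length zs) (≡-sym |xs′|) many) popular
      in R , B , c , (λ { (refl , ()) }) ,
         pattern-of us vs (≤-reflexive (≡-sym |us|)) |vs|
           (AllPairs-resp-⊆ us⊆ red′) (AllPairs-resp-⊆ (⊆-trans vs⊆ zs⊆) blue) complete

  mixed-or-clique : ∀ {s a b c} → Pattern s a b c → Mixed s ⊎ ∃ λ xs → s ≤ length xs × Clique φ c xs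
  mixed-or-clique {s} {a} {b} {c} p with a ≟ᶜ c | b ≟ᶜ c
  ... | yes refl | yes refl = inj₂ (Pattern.left p , Pattern.m≤left p , Pattern.left-clique p)
  ... | no a≢c   | _        = inj₁ (a , b , c , a≢c ∘ proj₁ , p)
  ... | yes refl | no b≢c   = inj₁ (a , b , c , b≢c ∘ proj₂ , p)

  -- One pattern has red cross edges, another blue ones. If neither is mixed, the first contains a
  -- large red clique and the second a large blue one, and `mixed-from-cliques` combines these.
  mixed-pattern : ∀ m s → 1 ≤ m → 2 * (2 ^ (2 * m) * m) ≤ s → patternThreshold s ≤ N →
    (N C 2) / 2 ≤ numR φ → (N C 2) / 2 ≤ numB φ → Mixed m
  mixed-pattern m s 1≤m s-big N-big R≥ B≥
    = combine
        (let _ , _ , p = pattern-with-cross R s 1≤s N-big R≥ in mixed-or-clique p)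
        (let _ , _ , p = pattern-with-cross B s 1≤s N-big B≥ in mixed-or-clique p)
    where
    2m≤s : 2 * m ≤ s
    2m≤s = ≤-trans (*-monoʳ-≤ 2 (m≤n*m m (2 ^ (2 * m)) {{m^n≢0 2 (2 * m)}})) s-big
    m≤s : m ≤ s
    m≤s = ≤-trans (m≤n*m m 2) 2m≤s
    1≤s : 1 ≤ s
    1≤s = ≤-trans 1≤m m≤s
    combine : Mixed s ⊎ (∃ λ xs → s ≤ length xs × Clique φ R xs) →
              Mixed s ⊎ (∃ λ ys → s ≤ length ys × Clique φ B ys) → Mixed m
    combine (inj₁ mixed) _            = weaken-mixed m≤s mixed
    combine (inj₂ _)     (inj₁ mixed) = weaken-mixed m≤s mixed
    combine (inj₂ (xs , |xs| , red)) (inj₂ (ys , |ys| , blue)) =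
      mixed-from-cliques m 1≤m xs ys (≤-trans 2m≤s |xs|) (≤-trans s-big |ys|) red blue

-- Embedding into a mixed pattern

hue : Colour → Colour → Colour → Bool → Bool → Colour
hue a b c true  true  = a
hue a b c false false = b
hue a b c true  false = c
hue a b c false true  = c

module _ {n N : ℕ} (G : Graph n) (φ : Colouring N) {a b c : Colour} (p : Pattern φ n a b c) where

  open Pattern p

  place : Bool → Fin n → Fin N
  place true  u = lookup left (inject≤ u m≤left)
  place false u = lookup right (inject≤ u m≤right)

  place-edge : ∀ s t {u v} → u ≢ v → Edge φ (hue a b c s t) (place s u) (place t v)
  place-edge true  true  u≢v = AllPairs-lookup (edge-sym φ) left-clique (u≢v ∘ inject≤-injective m≤left m≤left _ _)
  place-edge false false u≢v = AllPairs-lookup (edge-sym φ) right-clique (u≢v ∘ inject≤-injective m≤right m≤right _ _)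
  place-edge true  false u≢v = All.lookup (All.lookup cross (∈-lookup _)) (∈-lookup _)
  place-edge false true  u≢v = edge-sym φ (All.lookup (All.lookup cross (∈-lookup _)) (∈-lookup _))

  module _ (X : Fin n → Bool) where

    embed : Fin n → Fin N
    embed u = place (X u) u

    embed-injective : Injective _≡_ _≡_ embed
    embed-injective {u} {v} eq with u ≟ v
    ... | yes u≡v = u≡v
    ... | no u≢v  = contradiction eq (proj₁ (place-edge (X u) (X v) u≢v))

    hueCount : (Colour → Bool) → ℕ
    hueCount is = pairSum n (λ u v → ⟦ adj G u v ⟧ * ⟦ is (hue a b c (X u) (X v)) ⟧)

    copy-count : ∀ is → countPairs n (λ u v → adj G u v ∧ is (col φ (embed u) (embed v))) ≡ hueCount is
    copy-count is = trans (countPairs≡pairSum n _) (pairSum-cong n λ u v u≢v →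
      trans (⟦∧⟧ (adj G u v) _)
        (cong (λ d → ⟦ adj G u v ⟧ * ⟦ is d ⟧) (proj₂ (place-edge (X u) (X v) u≢v))))

    hueCount-total : Regular 4 G → hueCount isR + hueCount isB ≡ n + n
    hueCount-total regular = begin
      hueCount isR + hueCount isB             ≡⟨ pairSum-+ n _ _ ⟨
      pairSum n _                             ≡⟨ pairSum-cong n (λ u v _ → one-colour ⟦ adj G u v ⟧ (hue a b c (X u) (X v))) ⟩
      pairSum n (λ u v → ⟦ adj G u v ⟧)       ≡⟨ totalEdges G regular ⟩
      2 * n                                   ≡⟨ cong (n +_) (+-identityʳ n) ⟩
      n + n                                   ∎
      where
      open ≡-Reasoning
      one-colour : ∀ k d → k * ⟦ isR d ⟧ + k * ⟦ isB d ⟧ ≡ k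
      one-colour k R rewrite *-identityʳ k | *-zeroʳ k = +-identityʳ k
      one-colour k B rewrite *-identityʳ k | *-zeroʳ k = refl

    -- The copy has 2n edges in two colours, so n edges of one colour force n of the other.
    balanced-embedding : Regular 4 G → hueCount isR ≡ n ⊎ hueCount isB ≡ n → HasBalancedCopy G φ
    balanced-embedding regular half = embed , embed-injective ,
      ≤-trans (≤-reflexive equal) (n≤1+n _) , ≤-trans (≤-reflexive (≡-sym equal)) (n≤1+n _)
      where
      complement : hueCount isR ≡ n ⊎ hueCount isB ≡ n → hueCount isR ≡ hueCount isB
      complement (inj₁ R≡n) = trans R≡n (≡-sym (+-cancelˡ-≡ n _ _
        (trans (cong (_+ hueCount isB) (≡-sym R≡n)) (hueCount-total regular))))
      complement (inj₂ B≡n) = trans (+-cancelʳ-≡ n _ _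
        (trans (cong (hueCount isR +_) (≡-sym B≡n)) (hueCount-total regular))) (≡-sym B≡n)
      equal : copyR G φ embed ≡ copyB G φ embed
      equal = trans (copy-count isR) (trans (complement half) (≡-sym (copy-count isB)))

balanced-copy : ∀ {n N} (G : Graph n) (φ : Colouring N) → Regular 4 G → 4 ∣ n → Mixed φ n → HasBalancedCopy G φ
balanced-copy {n} G φ regular (divides q n≡q*4) (a , b , c , mixed , p) = by-colours a b c mixed p
  where
  n≡4q : n ≡ 4 * q
  n≡4q = trans n≡q*4 (*-comm q 4)

  W X : Fin n → Bool
  W = proj₁ (half-induced G regular q n≡4q)
  X = proj₁ (half-cut G regular q n≡4q)

  induced : pairSum n (λ u v → ⟦ adj G u v ⟧ * ⟦ W u ∧ W v ⟧) ≡ n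
  induced = trans (pairSum-cong n λ u v _ → cong (⟦ adj G u v ⟧ *_) (⟦∧⟧ (W u) (W v)))
    (proj₂ (half-induced G regular q n≡4q))

  cut : pairSum n (λ u v → ⟦ adj G u v ⟧ * ⟦ X u xor X v ⟧) ≡ n
  cut = proj₂ (half-cut G regular q n≡4q)

  agree : ∀ {A : Set} (f g : Bool → Bool → A) → f true true ≡ g true true → f true false ≡ g true false →
    f false true ≡ g false true → f false false ≡ g false false → ∀ s t → f s t ≡ g s t
  agree f g tt tf ft ff true  true  = tt
  agree f g tt tf ft ff true  false = tf
  agree f g tt tf ft ff false true  = ft
  agree f g tt tf ft ff false false = ff

  recount : ∀ (f g : Bool → Bool → Bool) (Y : Fin n → Bool) → (∀ s t → f s t ≡ g s t) →
    pairSum n (λ u v → ⟦ adj G u v ⟧ * ⟦ g (Y u) (Y v) ⟧) ≡ n →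
    pairSum n (λ u v → ⟦ adj G u v ⟧ * ⟦ f (Y u) (Y v) ⟧) ≡ n
  recount f g Y f≗g = trans (pairSum-cong n λ u v _ → cong (λ b → ⟦ adj G u v ⟧ * ⟦ b ⟧) (f≗g (Y u) (Y v)))

  by-colours : ∀ a b c → ¬ (a ≡ c × b ≡ c) → Pattern φ n a b c → HasBalancedCopy G φ
  by-colours R R R mixed p = contradiction (refl , refl) mixed
  by-colours B B B mixed p = contradiction (refl , refl) mixed
  -- With both cliques of one colour, the other colour appears exactly on the cut edges.
  by-colours R R B _ p = balanced-embedding G φ p X regular
    (inj₂ (recount (λ s t → isB (hue R R B s t)) _xor_ X (agree _ _ refl refl refl refl) cut))
  by-colours B B R _ p = balanced-embedding G φ p X regular
    (inj₁ (recount (λ s t → isR (hue B B R s t)) _xor_ X (agree _ _ refl refl refl refl) cut))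
  -- The colour of the left clique occurs nowhere else, so it is carried exactly by the edges
  -- induced by `W`.
  by-colours R B B _ p = balanced-embedding G φ p W regular
    (inj₁ (recount (λ s t → isR (hue R B B s t)) _∧_ W (agree _ _ refl refl refl refl) induced))
  by-colours B R R _ p = balanced-embedding G φ p W regular
    (inj₂ (recount (λ s t → isB (hue B R R s t)) _∧_ W (agree _ _ refl refl refl refl) induced))
  -- Now the right clique has the lone colour, so `W` goes to the right and its complement to the
  -- left.
  by-colours R B R _ p = balanced-embedding G φ p (not ∘ W) regular
    (inj₂ (recount (λ s t → isB (hue R B R (not s) (not t))) _∧_ W (agree _ _ refl refl refl refl) induced))
  by-colours B R B _ p = balanced-embedding G φ p (not ∘ W) regular
    (inj₁ (recount (λ s t → isR (hue B R B (not s) (not t))) _∧_ W (agree _ _ refl refl refl refl) induced))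

-- Exhaustive search

-- Without function extensionality, predicates on functions can only be decided up to pointwise equality.
Searchable : (A : Set) → (A → A → Set) → Set₁
Searchable A _≈_ = ∀ {P : A → Set} → (∀ {x y} → x ≈ y → P x → P y) → (∀ x → Dec (P x)) → Dec (∃ P)

search-Fin : ∀ {n} → Searchable (Fin n) _≡_
search-Fin _ = any?

search-Colour : Searchable Colour _≡_
search-Colour _ P? with P? R | P? B
... | yes r | _     = yes (R , r)
... | no _  | yes b = yes (B , b)
... | no ¬r | no ¬b = no λ { (R , r) → ¬r r ; (B , b) → ¬b b }

-- The first value is found by `search` and the remaining ones recursively. Leaving `_≈_` arbitrary
-- allows a second application, to functions of two arguments.
search-→ : ∀ {A : Set} {_≈_ : A → A → Set} → (∀ {x} → x ≈ x) → Searchable A _≈_ →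
  ∀ n → Searchable (Fin n → A) (λ f g → ∀ i → f i ≈ g i)
search-→ {A} ≈-refl search zero resp P? =
  map′ (λ p → empty , p) (λ { (f , p) → resp (λ ()) p }) (P? empty)
  where
  empty : Fin 0 → A
  empty ()
search-→ {_≈_ = _≈_} ≈-refl search (suc n) {P} resp P? =
  map′ (λ { (x , f , p) → x Vector.∷ f , p })
       (λ { (f , p) → Vector.head f , Vector.tail f , resp (λ { zero → ≈-refl ; (suc i) → ≈-refl }) p })
       (search {P = λ x → ∃ λ f → P (x Vector.∷ f)}
         (λ { x≈y (f , p) → f , resp (λ { zero → x≈y ; (suc i) → ≈-refl }) p })
         (λ x → search-→ ≈-refl search n
           (λ f≈g → resp λ { zero → ≈-refl ; (suc i) → f≈g i }) (λ f → P? (x Vector.∷ f))))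

countPairs-cong : ∀ n {p p′ : Fin n → Fin n → Bool} → (∀ i j → p i j ≡ p′ i j) → countPairs n p ≡ countPairs n p′
countPairs-cong n eq = trans (countPairs≡pairSum n _)
  (trans (pairSum-cong n λ i j _ → cong ⟦_⟧ (eq i j)) (≡-sym (countPairs≡pairSum n _)))

_≈ᶜ_ : ∀ {N} → Colouring N → Colouring N → Set
φ ≈ᶜ ψ = ∀ i j → col φ i j ≡ col ψ i j

Balanced : ∀ {m N} → Graph m → Colouring N → (Fin m → Fin N) → Set
Balanced G φ f = Injective _≡_ _≡_ f × (copyR G φ f ≤ suc (copyB G φ f)) × (copyB G φ f ≤ suc (copyR G φ f))

balanced-resp : ∀ {m N} (G : Graph m) {φ ψ : Colouring N} {f g : Fin m → Fin N} →
  φ ≈ᶜ ψ → (∀ u → f u ≡ g u) → Balanced G φ f → Balanced G ψ g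
balanced-resp {m} G {φ} {ψ} {f} {g} φ≈ψ f≗g (injective , R≤B , B≤R) =
  (λ {u} {v} gu≡gv → injective (trans (f≗g u) (trans gu≡gv (≡-sym (f≗g v))))) ,
  subst₂ (λ r b → r ≤ suc b) (same isR) (same isB) R≤B ,
  subst₂ (λ r b → b ≤ suc r) (same isR) (same isB) B≤R
  where
  same : ∀ is → countPairs m (λ u v → adj G u v ∧ is (col φ (f u) (f v))) ≡
                countPairs m (λ u v → adj G u v ∧ is (col ψ (g u) (g v)))
  same is = countPairs-cong m λ u v → cong (λ c → adj G u v ∧ is c)
    (trans (cong₂ (col φ) (f≗g u) (f≗g v)) (φ≈ψ (g u) (g v)))

hasBalancedCopy? : ∀ {m N} (G : Graph m) (φ : Colouring N) → Dec (HasBalancedCopy G φ)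
hasBalancedCopy? {m} G φ = search-→ refl search-Fin m
  (balanced-resp G {φ} {φ} (λ _ _ → refl))
  (λ f → map′ (λ inj {u} {v} → inj u v) (λ inj u v → inj) (all? λ u → all? λ v → (f u ≟ f v) →-dec (u ≟ v))
    ×-dec (copyR G φ f ≤? suc (copyB G φ f)) ×-dec (copyB G φ f ≤? suc (copyR G φ f)))

-- A `Colouring` contains a symmetry proof, so the search runs over plain tables instead; only the
-- entries `g i j` with i ≤ j are read.
symmetrise : ∀ {N} → (Fin N → Fin N → Colour) → Colouring N
symmetrise g .col i j = if ⌊ toℕ i <? toℕ j ⌋ then g i j else g j i
symmetrise g .colSym i j with <-cmp (toℕ i) (toℕ j)
... | tri< i<j _ j≮i rewrite ⌊⌋-yes (toℕ i <? toℕ j) i<j | ⌊⌋-no (toℕ j <? toℕ i) j≮i = refl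
... | tri≈ _ i≡j _ rewrite toℕ-injective i≡j = refl
... | tri> i≮j _ j<i rewrite ⌊⌋-yes (toℕ j <? toℕ i) j<i | ⌊⌋-no (toℕ i <? toℕ j) i≮j = refl

symmetrise-col : ∀ {N} (φ : Colouring N) → symmetrise (col φ) ≈ᶜ φ
symmetrise-col φ i j with ⌊ toℕ i <? toℕ j ⌋
... | true  = refl
... | false = colSym φ j i

Counterexample : ∀ {m N} → ℕ → Graph m → Colouring N → Set
Counterexample k G φ = k < numR φ × k < numB φ × ¬ HasBalancedCopy G φ

counterexample-resp : ∀ {m N k} (G : Graph m) (φ ψ : Colouring N) → φ ≈ᶜ ψ →
  Counterexample k G φ → Counterexample k G ψ
counterexample-resp {N = N} {k} G φ ψ φ≈ψ (k<R , k<B , none) =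
  subst (k <_) (countPairs-cong N λ i j → cong isR (φ≈ψ i j)) k<R ,
  subst (k <_) (countPairs-cong N λ i j → cong isB (φ≈ψ i j)) k<B ,
  λ { (f , balanced) → none (f , balanced-resp G {ψ} {φ} (λ i j → ≡-sym (φ≈ψ i j)) (λ _ → refl) balanced) }

-- A bound fails only through a counterexample, which is searched for among finitely many tables.
-- Decidability is what lets `least` extract the smallest bound.
balProperty? : ∀ {m} N (G : Graph m) k → Dec (BalProperty N G k)
balProperty? N G k = (k <? (N C 2) / 2) ×-dec map′ sound complete (¬? counterexample?)
  where
  counterexample? : Dec (∃ λ g → Counterexample k G (symmetrise {N} g))
  counterexample? = search-→ (λ _ → refl) (search-→ refl search-Colour N) N
    (λ {g} {h} g≈h → counterexample-resp G (symmetrise g) (symmetrise h) λ i j →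
      cong₂ (if_then_else_ ⌊ toℕ i <? toℕ j ⌋) (g≈h i j) (g≈h j i))
    (λ g → (k <? numR (symmetrise g)) ×-dec (k <? numB (symmetrise g)) ×-dec ¬? (hasBalancedCopy? G (symmetrise g)))
  sound : ¬ (∃ λ g → Counterexample k G (symmetrise {N} g)) →
    (φ : Colouring N) → k < numR φ → k < numB φ → HasBalancedCopy G φ
  sound none φ k<R k<B with hasBalancedCopy? G φ
  ... | yes copy = copy
  ... | no ¬copy = contradiction
    (col φ , counterexample-resp G φ (symmetrise (col φ)) (λ i j → ≡-sym (symmetrise-col φ i j)) (k<R , k<B , ¬copy)) none
  complete : ((φ : Colouring N) → k < numR φ → k < numB φ → HasBalancedCopy G φ) →
    ¬ (∃ λ g → Counterexample k G (symmetrise {N} g))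
  complete all (g , k<R , k<B , ¬copy) = ¬copy (all (symmetrise g) k<R k<B)

-- Extraction of the least bound

least : ∀ {P : ℕ → Set} → (∀ k → Dec (P k)) → ∀ k → P k → ∃ λ m → P m × (∀ j → j < m → ¬ P j)
least {P} P? k = go k (<-wellFounded k)
  where
  go : ∀ k → Acc _<_ k → P k → ∃ λ m → P m × (∀ j → j < m → ¬ P j)
  go k (acc rec) Pk with anyUpTo? P? k
  ... | yes (j , j<k , Pj) = go j (rec j<k) Pj
  ... | no none            = k , Pk , λ j j<k Pj → none (j , j<k , Pj)

-- The value 0 would give N² ≤ N + 2 < 2N ≤ N². Positivity makes `pred` a true predecessor in the
-- theorem.
halfPairs-positive : ∀ N → 4 ≤ N → 1 ≤ (N C 2) / 2
halfPairs-positive N 4≤N = n≢0⇒n>0 λ h≡0 → <-irrefl refl (begin-strict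
  N * N                        ≤⟨ square≤halfPairs N ⟩
  4 * ((N C 2) / 2) + 2 + N    ≡⟨ cong (λ h → 4 * h + 2 + N) h≡0 ⟩
  2 + N                        <⟨ +-monoˡ-≤ N (≤-trans (n≤1+n 3) 4≤N) ⟩
  N + N                        ≡⟨ cong (N +_) (+-identityʳ N) ⟨
  2 * N                        ≤⟨ *-monoˡ-≤ N (≤-trans (s≤s (s≤s z≤n)) 4≤N) ⟩
  N * N                        ∎)
  where open ≤-Reasoning

theorem6p5 : (n : ℕ) (G : Graph n) → Regular 4 G → 4 ∣ n → Balanceable G
theorem6p5 n G regular 4∣n = patternThreshold s , λ N N-big →
  least (balProperty? N G) (pred ((N C 2) / 2)) (property N N-big)
  where
  -- The size that `mixed-pattern` requires for m = n + 1; taking n + 1 instead of n secures `1 ≤ m`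
  -- when n = 0, and `weaken-mixed` returns to n.
  s : ℕ
  s = 2 * (2 ^ (2 * suc n) * suc n)
  -- The largest admissible bound suffices: exceeding it means having at least ⌊½ C(N,2)⌋ edges,
  -- which is what `mixed-pattern` assumes of both colours.
  property : ∀ N → patternThreshold s ≤ N → BalProperty N G (pred ((N C 2) / 2))
  property N N-big = ≤-reflexive above , λ φ many-R many-B →
    balanced-copy G φ regular 4∣n (weaken-mixed φ (n≤1+n n)
      (mixed-pattern φ (suc n) s (s≤s z≤n) ≤-refl N-big
        (≤-trans (≤-reflexive (≡-sym above)) many-R) (≤-trans (≤-reflexive (≡-sym above)) many-B)))
    where
    above : suc (pred ((N C 2) / 2)) ≡ (N C 2) / 2
    above = suc-pred _ {{>-nonZero (halfPairs-positive N (≤-trans (4≤patternThreshold s) N-big))}}
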